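{- Let $G=(V,E)$ be a connected simple graph with $n$ vertices. Then (a) $$\sum_{uv\in E}\frac{1}{|N(u)\cap N(v)|+2}\ \ge\ \frac{n-1}{2},$$ where the sum runs over the edges of $G$ (each edge counted once); (b) equality holds in (a) if and only if every biconnected component of $G$ is a clique.
   Context: For a vertex $u$, $N(u)=\{v\in V: uv\in E\}$ is its open neighbourhood (so $u\notin N(u)$), and $N(u)\cap N(v)$ is the set of common neighbours of $u$ and $v$. A biconnected component (block) of $G$ is a maximal connected subgraph of $G$ that has no cut vertex of its own; in particular a bridge together with its two endpoints forms a biconnected component (isomorphic to $K_2$). -}

module Defs where

open import Data.Fin using (Fin; _<?_)
open import Data.Fin.Properties using (_≟_)
open import Data.Fin.Subset using (Subset; _∈_; _⊆_; _∩_; _-_; ∣_∣; Nonempty)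
open import Data.Fin.Subset.Properties using (x∈p∧x≢y⇒x∈p-y)
open import Data.Integer as ℤ using (+_)
open import Data.List using (List; allFin; cartesianProduct; filter; foldr; map)
open import Data.Nat as ℕ using (ℕ)
open import Data.Product using (_×_; _,_; ∃₂)
open import Data.Rational as ℚ using (ℚ; 0ℚ; _/_)
open import Data.Vec using (tabulate)
open import Level using (0ℓ)
open import Relation.Binary using (Rel; Decidable; Symmetric; Irreflexive)
open import Relation.Binary.Construct.Closure.ReflexiveTransitive using (Star)
open import Relation.Binary.PropositionalEquality using (_≡_; _≢_)
open import Relation.Nullary using (¬_; does)
open import Relation.Nullary.Decidable using (_×-dec_; ¬?)

record Graph (n : ℕ) : Set₁ where
  field
    Adj    : Rel (Fin n) 0ℓ
    Adj?   : Decidable Adj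
    sym    : Symmetric Adj
    irrefl : Irreflexive _≡_ Adj

  -- The first component excludes the graph with no vertices.
  Connected : Set
  Connected = Fin n × (∀ u v → Star Adj u v)

  N : Fin n → Subset n
  N u = tabulate (λ v → does (Adj? u v))

  -- Each edge {u , v} is listed once, as the pair with u < v.
  edges : List (Fin n × Fin n)
  edges = filter (λ (u , v) → (u <? v) ×-dec Adj? u v)
                 (cartesianProduct (allFin n) (allFin n))

  edgeSum : (Fin n → Fin n → ℚ) → ℚ
  edgeSum f = foldr ℚ._+_ 0ℚ (map (λ (u , v) → f u v) edges)

  weight : Fin n → Fin n → ℚ
  weight u v = + 1 / (2 ℕ.+ ∣ N u ∩ N v ∣)

open Graph

-- Subgraphs need not be induced.
record Subgraph {n} (G : Graph n) : Set₁ where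
  field
    vertices : Subset n
    Edge     : Rel (Fin n) 0ℓ
    Edge?    : Decidable Edge
    Edge-sym : Symmetric Edge
    Edge⇒∈   : ∀ {u v} → Edge u v → u ∈ vertices
    Edge⇒Adj : ∀ {u v} → Edge u v → Adj G u v

open Subgraph

module _ {n} {G : Graph n} where

  infix 4 _≤ₛ_

  _≤ₛ_ : Subgraph G → Subgraph G → Set
  H ≤ₛ K = vertices H ⊆ vertices K × (∀ {u v} → Edge H u v → Edge K u v)

  delete : Subgraph G → Fin n → Subgraph G
  delete H x = record
    { vertices = vertices H - x
    ; Edge     = λ u v → Edge H u v × u ≢ x × v ≢ x
    ; Edge?    = λ u v → Edge? H u v ×-dec ¬? (u ≟ x) ×-dec ¬? (v ≟ x)
    ; Edge-sym = λ (e , u≢x , v≢x) → Edge-sym H e , v≢x , u≢x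
    ; Edge⇒∈   = λ (e , u≢x , _) → x∈p∧x≢y⇒x∈p-y (Edge⇒∈ H e) u≢x
    ; Edge⇒Adj = λ (e , _) → Edge⇒Adj H e
    }

  ConnectedSubgraph : Subgraph G → Set
  ConnectedSubgraph H =
    Nonempty (vertices H) ×
    (∀ {u v} → u ∈ vertices H → v ∈ vertices H → Star (Edge H) u v)

  -- Deleting x splits a connected component of H into several.
  IsCutVertex : Subgraph G → Fin n → Set
  IsCutVertex H x = x ∈ vertices H × ∃₂ λ u v →
    u ∈ vertices (delete H x) × v ∈ vertices (delete H x) ×
    Star (Edge H) u v × ¬ Star (Edge (delete H x)) u v

  Biconnected : Subgraph G → Set
  Biconnected H = ConnectedSubgraph H × (∀ x → ¬ IsCutVertex H x)

  IsBlock : Subgraph G → Set₁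
  IsBlock H = Biconnected H × (∀ K → Biconnected K → H ≤ₛ K → K ≤ₛ H)

  IsClique : Subgraph G → Set
  IsClique H = ∀ {u v} → u ∈ vertices H → v ∈ vertices H → u ≢ v → Edge H u v

{-# OPTIONS --safe #-}

-- Write c(uv) = |N(u) ∩ N(v)|, let F(H) be the sum of 1/(c(uv)+2) over the ordered adjacent pairs of a
-- subgraph H (twice the sum over edges), and let k(H) be its number of components.  Then F(H) ≥ |H| − k(H),
-- by induction on |H|, averaging over all vertex deletions:
--   Σ_w F(H−w) = |H| F(H) − Σ_w Σ_{x ∈ N(w)} 1/(c(xw)+1).
-- Deleting w splits its component into k(H−w) − k(H) + 1 = Σ_{x ∈ N(w)} 1/m(x) parts, where m(x) is the
-- number of neighbours of w in the part of x.  Now m(x) ≥ c(xw)+1, because x and the common neighbours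
-- of x and w lie in that part.  Equality holds throughout iff any two neighbours of a vertex w that are
-- connected in H−w are adjacent, and for G itself this says that the blocks are cliques.

module Submission where

open import Algebra.Bundles using (CommutativeRing)
import Algebra.Properties.Semiring.Sum as Sum
open import Data.Bool using (true; if_then_else_)
open import Data.Fin using (Fin; zero; suc; _<?_)
import Data.Fin as Fin
open import Data.Fin.Properties using (_≟_; any?; <-cmp)
open import Data.Fin.Subset using (Subset; inside; outside; _∈_; _∉_; _⊆_; _⊃_; _∩_; _∪_; _─_; ⁅_⁆; ∣_∣; ⊤; Nonempty)
open import Data.Fin.Subset.Induction using (⊃-wellFounded)
open import Data.Fin.Subset.Properties
  using (_∈?_; ∈⊤; drop-there; nonempty?; p─q⊆p; x∈⁅x⁆; x∈⁅y⁆⇒x≡y; x∈p∧x≢y⇒x∈p-y; x∈p⇒∣p-x∣<∣p∣;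
         x∈p∩q⁺; x∈p∩q⁻; x∈p∪q⁺; x∈p∪q⁻)
import Data.Integer as ℤ
import Data.Integer.Properties as ℤ
open import Data.List as List using (List; []; _∷_; _++_; allFin; cartesianProduct; filter; foldr; map)
open import Data.List.Membership.Propositional using () renaming (_∈_ to _∈ₗ_)
open import Data.List.Membership.Propositional.Properties using (∈-allFin)
open import Data.List.Properties using (map-tabulate; map-++; map-∘)
open import Data.List.Relation.Unary.Any using (here; there)
open import Data.Nat as ℕ using (ℕ)
import Data.Nat.Properties as ℕ
open import Data.Product using (_×_; _,_; proj₁; proj₂; ∃)
open import Data.Rational as ℚ using (ℚ; 0ℚ; 1ℚ; _/_; _≥_)
import Data.Rational.Properties as ℚ
open import Data.Rational.Solver using (module +-*-Solver)
open import Data.Rational.Unnormalised using (mkℚᵘ; *≡*)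
import Data.Rational.Unnormalised as ℚᵘ
import Data.Rational.Unnormalised.Properties as ℚᵘ
open import Data.Sum using (_⊎_; inj₁; inj₂)
open import Data.Vec using (_∷_; []; here; there)
open import Data.Vec.Properties using ([]=⇒lookup; lookup⇒[]=; lookup∘tabulate)
open import Function using (_∘_)
open import Function.Bundles using (_⇔_; mk⇔)
open import Induction.WellFounded using (Acc; acc)
open import Level using (0ℓ)
open import Relation.Binary using (Rel; Decidable; Symmetric; Transitive; tri<; tri≈; tri>)
open import Relation.Binary.Construct.Closure.ReflexiveTransitive using (Star; ε; _◅_; _◅◅_)
  renaming (map to Star-map; reverse to Star-reverse)
open import Relation.Binary.PropositionalEquality
open import Relation.Nullary using (¬_; Dec; yes; no; does; contradiction)
open import Relation.Nullary.Decidable using (_×-dec_; _⊎-dec_; ¬?; map′; dec-true; decidable-stable)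
import Relation.Unary as Unary
open import Defs

-- Deleting a vertex can disconnect a connected graph, so an induction confined to connected graphs
-- would break; the term k(H) lets it run over all subgraphs, with common neighbours recounted
-- inside each of them. The estimate m(x) ≥ c(xw)+1 is not inserted into the average. What it gives
-- away at w is kept as a separate term, the slack at w, and |H| times the gap F(H) + k(H) - |H| is
-- exactly the sum over w of the gap of H-w and the slack at w. All these terms are non-negative, so
-- one identity yields both the inequality and its equality case; for the converse direction of the
-- latter, the equality condition is seen to pass from H to every H-w.

-- A module of its own because the theorem writes _-_ for the subtraction of integers.
module Gap where

  open import Data.Rational using (_+_; _*_; _-_; _≤_; _<_)
  open +-*-Solver using (solve; _:=_; _:+_; _:-_; _:*_; con)
  module ℚ-Sum = Sum (CommutativeRing.semiring ℚ.+-*-commutativeRing)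

  private
    variable
      n : ℕ
      P Q : Set

  -- Ordered-field arithmetic and total reciprocals in ℚ.

  p-p≡0 : ∀ p → p - p ≡ 0ℚ
  p-p≡0 = ℚ.+-inverseʳ

  p-q≡0⇒p≡q : ∀ p q → p - q ≡ 0ℚ → p ≡ q
  p-q≡0⇒p≡q p q eq = begin
    p            ≡⟨ solve 2 (λ p q → p := (p :- q) :+ q) refl p q ⟩
    (p - q) + q  ≡⟨ cong (_+ q) eq ⟩
    0ℚ + q       ≡⟨ ℚ.+-identityˡ q ⟩
    q            ∎
    where open ≡-Reasoning

  0≤q-p⇒p≤q : ∀ {p q} → 0ℚ ≤ q - p → p ≤ q
  0≤q-p⇒p≤q {p} {q} h = begin
    p            ≡⟨ ℚ.+-identityˡ p ⟨
    0ℚ + p       ≤⟨ ℚ.+-monoˡ-≤ p h ⟩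
    (q - p) + p  ≡⟨ solve 2 (λ p q → (q :- p) :+ p := q) refl p q ⟩
    q            ∎
    where open ℚ.≤-Reasoning

  p≤q⇒0≤q-p : ∀ {p q} → p ≤ q → 0ℚ ≤ q - p
  p≤q⇒0≤q-p {p} {q} h = subst (_≤ q - p) (p-p≡0 p) (ℚ.+-monoˡ-≤ (ℚ.- p) h)

  +-nonneg : ∀ {p q} → 0ℚ ≤ p → 0ℚ ≤ q → 0ℚ ≤ p + q
  +-nonneg = ℚ.+-mono-≤

  0<1 : 0ℚ < 1ℚ
  0<1 = ℚ.positive⁻¹ 1ℚ

  *-nonneg : ∀ {p q} → 0ℚ ≤ p → 0ℚ ≤ q → 0ℚ ≤ p * q
  *-nonneg {p} {q} 0≤p 0≤q =
    subst (_≤ p * q) (ℚ.*-zeroʳ p) (ℚ.*-monoˡ-≤-nonNeg p {{ℚ.nonNegative 0≤p}} 0≤q)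

  <⇒≢0 : ∀ {p} → 0ℚ < p → p ≢ 0ℚ
  <⇒≢0 0<p refl = ℚ.<-irrefl refl 0<p

  ≤∧≢⇒< : ∀ {p q} → p ≤ q → p ≢ q → p < q
  ≤∧≢⇒< p≤q p≢q = ℚ.≰⇒> (λ q≤p → p≢q (ℚ.≤-antisym p≤q q≤p))

  +-pos : ∀ {p q} → 0ℚ < p → 0ℚ ≤ q → 0ℚ < p + q
  +-pos = ℚ.+-mono-<-≤

  nonneg-+≡0 : ∀ {p q} → 0ℚ ≤ p → 0ℚ ≤ q → p + q ≡ 0ℚ → p ≡ 0ℚ × q ≡ 0ℚ
  nonneg-+≡0 {p} {q} 0≤p 0≤q eq = p≡0 , (begin
    q       ≡⟨ ℚ.+-identityˡ q ⟨
    0ℚ + q  ≡⟨ cong (_+ q) p≡0 ⟨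
    p + q   ≡⟨ eq ⟩
    0ℚ      ∎)
    where
    open ≡-Reasoning
    p≡0 : p ≡ 0ℚ
    p≡0 = ℚ.≤-antisym
      (subst₂ _≤_ (ℚ.+-identityʳ p) eq (ℚ.+-monoʳ-≤ p 0≤q)) 0≤p

  -- inv and ∑ are opaque to keep the conversion checker out of rational arithmetic.
  opaque
    inv : ℚ → ℚ
    inv q with q ℚ.≟ 0ℚ
    -- The default value makes `inv` total, so that it can stand under sums in which some class
    -- sizes are 0; there it is multiplied by an indicator that is 0 as well.
    ... | yes _  = 0ℚ
    ... | no q≢0 = ℚ.1/_ q {{ℚ.≢-nonZero q≢0}}

    *-inv : ∀ {q} → q ≢ 0ℚ → q * inv q ≡ 1ℚ
    *-inv {q} q≢0 with q ℚ.≟ 0ℚ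
    ... | yes q≡0 = contradiction q≡0 q≢0
    ... | no q≢0′ = ℚ.*-inverseʳ q {{ℚ.≢-nonZero q≢0′}}

    inv-nonneg : ∀ {q} → 0ℚ ≤ q → 0ℚ ≤ inv q
    inv-nonneg {q} 0≤q with q ℚ.≟ 0ℚ
    ... | yes _  = ℚ.≤-refl
    ... | no q≢0 = ℚ.<⇒≤ (ℚ.positive⁻¹ (ℚ.1/_ q {{ℚ.≢-nonZero q≢0}})
                      {{ℚ.1/pos⇒pos q {{ℚ.positive (≤∧≢⇒< 0≤q (q≢0 ∘ sym))}}}})

  *-cancelˡ-≢0 : ∀ {r} p q → r ≢ 0ℚ → r * p ≡ r * q → p ≡ q
  *-cancelˡ-≢0 {r} p q r≢0 eq = begin
    p                ≡⟨ lemma p ⟩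
    inv r * (r * p)  ≡⟨ cong (inv r *_) eq ⟩
    inv r * (r * q)  ≡⟨ lemma q ⟨
    q                ∎
    where
    open ≡-Reasoning
    lemma : ∀ s → s ≡ inv r * (r * s)
    lemma s = begin
      s                ≡⟨ ℚ.*-identityˡ s ⟨
      1ℚ * s           ≡⟨ cong (_* s) (*-inv r≢0) ⟨
      (r * inv r) * s  ≡⟨ solve 3 (λ r i s → (r :* i) :* s := i :* (r :* s)) refl r (inv r) s ⟩
      inv r * (r * s)  ∎

  *-cancel-0≤ : ∀ {r p} → 0ℚ < r → 0ℚ ≤ r * p → 0ℚ ≤ p
  *-cancel-0≤ {r} {p} 0<r h = ℚ.*-cancelˡ-≤-pos r {{ℚ.positive 0<r}} (subst (_≤ r * p) (sym (ℚ.*-zeroʳ r)) h)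

  inv-diff : ∀ {p q} → 0ℚ < p → 0ℚ < q → inv p - inv q ≡ (q - p) * (inv p * inv q)
  inv-diff {p} {q} 0<p 0<q = begin
    inv p - inv q                              ≡⟨ solve 2 (λ i j → i :- j := con 1ℚ :* i :- con 1ℚ :* j) refl (inv p) (inv q) ⟩
    1ℚ * inv p - 1ℚ * inv q                    ≡⟨ cong₂ (λ x y → x * inv p - y * inv q) (sym (*-inv (<⇒≢0 0<q))) (sym (*-inv (<⇒≢0 0<p))) ⟩
    (q * inv q) * inv p - (p * inv p) * inv q  ≡⟨ solve 4 (λ p q i j → (q :* j) :* i :- (p :* i) :* j := (q :- p) :* (i :* j)) refl p q (inv p) (inv q) ⟩
    (q - p) * (inv p * inv q)                  ∎
    where open ≡-Reasoning

  inv-antimono-≤ : ∀ {p q} → 0ℚ < p → p ≤ q → 0ℚ ≤ inv p - inv q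
  inv-antimono-≤ {p} {q} 0<p p≤q = subst (0ℚ ≤_) (sym (inv-diff 0<p 0<q))
    (*-nonneg (p≤q⇒0≤q-p p≤q) (*-nonneg (inv-nonneg (ℚ.<⇒≤ 0<p)) (inv-nonneg (ℚ.<⇒≤ 0<q))))
    where
    0<q : 0ℚ < q
    0<q = ℚ.<-≤-trans 0<p p≤q

  inv-injective : ∀ {p q} → 0ℚ < p → 0ℚ < q → inv p ≡ inv q → p ≡ q
  inv-injective {p} {q} 0<p 0<q eq = *-cancelˡ-≢0 p q inv≢0 (begin
    inv p * p  ≡⟨ ℚ.*-comm (inv p) p ⟩
    p * inv p  ≡⟨ *-inv (<⇒≢0 0<p) ⟩
    1ℚ         ≡⟨ *-inv (<⇒≢0 0<q) ⟨
    q * inv q  ≡⟨ ℚ.*-comm q (inv q) ⟩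
    inv q * q  ≡⟨ cong (_* q) eq ⟨
    inv p * q  ∎)
    where
    open ≡-Reasoning
    inv≢0 : inv p ≢ 0ℚ
    inv≢0 ip≡0 with trans (sym (*-inv (<⇒≢0 0<p))) (trans (cong (p *_) ip≡0) (ℚ.*-zeroʳ p))
    ... | ()

  -- Iverson brackets.

  ⟦_⟧ : Dec P → ℚ
  ⟦ d ⟧ = if does d then 1ℚ else 0ℚ

  ⟦⟧-yes : (d : Dec P) → P → ⟦ d ⟧ ≡ 1ℚ
  ⟦⟧-yes (yes _) _ = refl
  ⟦⟧-yes (no ¬p) p = contradiction p ¬p

  ⟦⟧-no : (d : Dec P) → ¬ P → ⟦ d ⟧ ≡ 0ℚ
  ⟦⟧-no (yes p) ¬p = contradiction p ¬p
  ⟦⟧-no (no _)  _  = refl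

  0≤⟦⟧ : (d : Dec P) → 0ℚ ≤ ⟦ d ⟧
  0≤⟦⟧ (yes _) = ℚ.nonNegative⁻¹ 1ℚ
  0≤⟦⟧ (no _)  = ℚ.≤-refl

  ⟦⟧-mono : (d : Dec P) (e : Dec Q) → (P → Q) → ⟦ d ⟧ ≤ ⟦ e ⟧
  ⟦⟧-mono (no _)  e       _   = 0≤⟦⟧ e
  ⟦⟧-mono (yes _) (yes _) _   = ℚ.≤-refl
  ⟦⟧-mono (yes p) (no ¬q) p⇒q = contradiction (p⇒q p) ¬q

  ⟦⟧-cong : (d : Dec P) (e : Dec Q) → (P → Q) → (Q → P) → ⟦ d ⟧ ≡ ⟦ e ⟧
  ⟦⟧-cong d e p⇒q q⇒p = ℚ.≤-antisym (⟦⟧-mono d e p⇒q) (⟦⟧-mono e d q⇒p)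

  ⟦⟧-× : (d : Dec P) (e : Dec Q) → ⟦ d ×-dec e ⟧ ≡ ⟦ d ⟧ * ⟦ e ⟧
  ⟦⟧-× (yes _) (yes _) = refl
  ⟦⟧-× (yes _) (no _)  = refl
  ⟦⟧-× (no _)  e       = sym (ℚ.*-zeroˡ ⟦ e ⟧)

  ⟦⟧*-cong : (d : Dec P) {x y : ℚ} → (P → x ≡ y) → ⟦ d ⟧ * x ≡ ⟦ d ⟧ * y
  ⟦⟧*-cong (yes p)         x≡y = cong (1ℚ *_) (x≡y p)
  ⟦⟧*-cong (no _) {x} {y}  _   = trans (ℚ.*-zeroˡ x) (sym (ℚ.*-zeroˡ y))

  ⟦⟧*-0≤ : (d : Dec P) {x : ℚ} → (P → 0ℚ ≤ x) → 0ℚ ≤ ⟦ d ⟧ * x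
  ⟦⟧*-0≤ (yes p) {x} 0≤x = subst (0ℚ ≤_) (sym (ℚ.*-identityˡ x)) (0≤x p)
  ⟦⟧*-0≤ (no _)  {x} _   = ℚ.≤-reflexive (sym (ℚ.*-zeroˡ x))

  ⟦⟧-absorb : (d : Dec P) (e : Dec Q) → (Q → P) → ⟦ d ⟧ * ⟦ e ⟧ ≡ ⟦ e ⟧
  ⟦⟧-absorb d (yes q) q⇒p = trans (ℚ.*-identityʳ ⟦ d ⟧) (⟦⟧-yes d (q⇒p q))
  ⟦⟧-absorb d (no _)  _   = ℚ.*-zeroʳ ⟦ d ⟧

  ⟦⟧-no* : (d : Dec P) (x : ℚ) → ¬ P → ⟦ d ⟧ * x ≡ 0ℚ
  ⟦⟧-no* d x ¬p = trans (cong (_* x) (⟦⟧-no d ¬p)) (ℚ.*-zeroˡ x)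

  ⟦⟧-yes* : (d : Dec P) (x : ℚ) → P → ⟦ d ⟧ * x ≡ x
  ⟦⟧-yes* d x p = trans (cong (_* x) (⟦⟧-yes d p)) (ℚ.*-identityˡ x)

  -- Finite sums of rationals.

  opaque
    ∑ : (Fin n → ℚ) → ℚ
    ∑ = ℚ-Sum.sum

    ∑-cong : {f g : Fin n → ℚ} → (∀ i → f i ≡ g i) → ∑ f ≡ ∑ g
    ∑-cong = ℚ-Sum.sum-cong-≗

    ∑-+ : (f g : Fin n → ℚ) → ∑ (λ i → f i + g i) ≡ ∑ f + ∑ g
    ∑-+ = ℚ-Sum.∑-distrib-+

    ∑-comm : ∀ {m} (f : Fin m → Fin n → ℚ) → ∑ (λ i → ∑ (λ j → f i j)) ≡ ∑ (λ j → ∑ (λ i → f i j))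
    ∑-comm = ℚ-Sum.∑-comm

    *-∑ : ∀ c (f : Fin n → ℚ) → c * ∑ f ≡ ∑ (λ i → c * f i)
    *-∑ = ℚ-Sum.*-distribˡ-sum

    ∑-* : ∀ c (f : Fin n → ℚ) → ∑ f * c ≡ ∑ (λ i → f i * c)
    ∑-* = ℚ-Sum.*-distribʳ-sum

    ∑-zero : (f : Fin n → ℚ) → (∀ i → f i ≡ 0ℚ) → ∑ f ≡ 0ℚ
    ∑-zero {n} f f≡0 = trans (∑-cong f≡0) (ℚ-Sum.sum-replicate-zero n)

    ∑-neg : (f : Fin n → ℚ) → ∑ (λ i → ℚ.- f i) ≡ ℚ.- ∑ f
    ∑-neg {ℕ.zero}  f = refl
    ∑-neg {ℕ.suc n} f = trans (cong (λ s → ℚ.- f zero + s) (∑-neg (f ∘ suc)))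
                              (sym (ℚ.neg-distrib-+ (f zero) (∑ (f ∘ suc))))

    ∑-minus : (f g : Fin n → ℚ) → ∑ (λ i → f i - g i) ≡ ∑ f - ∑ g
    ∑-minus f g = trans (∑-+ f (λ i → ℚ.- g i)) (cong (∑ f +_) (∑-neg g))

    ∑-nonneg : (f : Fin n → ℚ) → (∀ i → 0ℚ ≤ f i) → 0ℚ ≤ ∑ f
    ∑-nonneg {ℕ.zero}  f 0≤f = ℚ.≤-refl
    ∑-nonneg {ℕ.suc n} f 0≤f = +-nonneg (0≤f zero) (∑-nonneg (f ∘ suc) (0≤f ∘ suc))

    ∑≡0⇒≡0 : (f : Fin n → ℚ) → (∀ i → 0ℚ ≤ f i) → ∑ f ≡ 0ℚ → ∀ i → f i ≡ 0ℚ
    ∑≡0⇒≡0 f 0≤f eq zero    = proj₁ (nonneg-+≡0 (0≤f zero) (∑-nonneg (f ∘ suc) (0≤f ∘ suc)) eq)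
    ∑≡0⇒≡0 f 0≤f eq (suc i) = ∑≡0⇒≡0 (f ∘ suc) (0≤f ∘ suc)
      (proj₂ (nonneg-+≡0 (0≤f zero) (∑-nonneg (f ∘ suc) (0≤f ∘ suc)) eq)) i

    ∑-pos : (f : Fin n → ℚ) → (∀ i → 0ℚ ≤ f i) → ∀ i → 0ℚ < f i → 0ℚ < ∑ f
    ∑-pos f 0≤f i 0<fi = ≤∧≢⇒< (∑-nonneg f 0≤f)
      (λ 0≡sum → <⇒≢0 0<fi (∑≡0⇒≡0 f 0≤f (sym 0≡sum) i))

    ∑-diag : (f : Fin n → ℚ) (j : Fin n) → ∑ (λ i → ⟦ i ≟ j ⟧ * f i) ≡ f j
    ∑-diag f zero = begin
      1ℚ * f zero + ∑ (λ i → 0ℚ * f (suc i))  ≡⟨ cong₂ _+_ (ℚ.*-identityˡ (f zero)) (∑-zero _ (λ i → ℚ.*-zeroˡ (f (suc i)))) ⟩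
      f zero + 0ℚ                             ≡⟨ ℚ.+-identityʳ (f zero) ⟩
      f zero                                  ∎
      where open ≡-Reasoning
    ∑-diag f (suc j) = begin
      0ℚ * f zero + ∑ (λ i → ⟦ suc i ≟ suc j ⟧ * f (suc i))  ≡⟨ cong₂ _+_ (ℚ.*-zeroˡ (f zero)) (∑-cong (λ i → cong (_* f (suc i)) (⟦⟧-cong (suc i ≟ suc j) (i ≟ j) (λ { refl → refl }) (cong suc)))) ⟩
      0ℚ + ∑ (λ i → ⟦ i ≟ j ⟧ * f (suc i))                   ≡⟨ ℚ.+-identityˡ _ ⟩
      ∑ (λ i → ⟦ i ≟ j ⟧ * f (suc i))                        ≡⟨ ∑-diag (f ∘ suc) j ⟩
      f (suc j)                                              ∎
      where open ≡-Reasoning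

  ∑-δ : ∀ {n} (j : Fin n) → ∑ (λ i → ⟦ i ≟ j ⟧) ≡ 1ℚ
  ∑-δ j = trans (∑-cong (λ i → sym (ℚ.*-identityʳ ⟦ i ≟ j ⟧))) (∑-diag (λ _ → 1ℚ) j)

  ⟦⟧-split : {P : Set} (d : Dec P) (x : ℚ) → x ≡ ⟦ d ⟧ * x + ⟦ ¬? d ⟧ * x
  ⟦⟧-split (yes _) x = solve 1 (λ x → x := con 1ℚ :* x :+ con 0ℚ :* x) refl x
  ⟦⟧-split (no _)  x = solve 1 (λ x → x := con 0ℚ :* x :+ con 1ℚ :* x) refl x

  ⟦⟧*⟦⟧-cong : {P Q P′ Q′ : Set} (p : Dec P) (q : Dec Q) (p′ : Dec P′) (q′ : Dec Q′) →
               (P → Q → P′ × Q′) → (P′ → Q′ → P × Q) → ⟦ p ⟧ * ⟦ q ⟧ ≡ ⟦ p′ ⟧ * ⟦ q′ ⟧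
  ⟦⟧*⟦⟧-cong p q p′ q′ f g = begin
    ⟦ p ⟧ * ⟦ q ⟧    ≡⟨ ⟦⟧-× p q ⟨
    ⟦ p ×-dec q ⟧    ≡⟨ ⟦⟧-cong (p ×-dec q) (p′ ×-dec q′) (λ (x , y) → f x y) (λ (x , y) → g x y) ⟩
    ⟦ p′ ×-dec q′ ⟧  ≡⟨ ⟦⟧-× p′ q′ ⟩
    ⟦ p′ ⟧ * ⟦ q′ ⟧  ∎
    where open ≡-Reasoning

  -- Set difference, and decidability of reachability.

  x∈p─q⇒x∉q : ∀ {n} (p q : Subset n) {x} → x ∈ p ─ q → x ∉ q
  x∈p─q⇒x∉q (_ ∷ p) (outside ∷ q) (there x∈) (there x∈q) = x∈p─q⇒x∉q p q x∈ x∈q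
  x∈p─q⇒x∉q (_ ∷ p) (inside  ∷ q) (there x∈) (there x∈q) = x∈p─q⇒x∉q p q x∈ x∈q

  -- Warshall's algorithm: Via E ws u v allows the members of ws as intermediate vertices.
  module _ {n} {E : Rel (Fin n) 0ℓ} where

    Via : List (Fin n) → Rel (Fin n) 0ℓ
    Via []       u v = u ≡ v ⊎ E u v
    Via (w ∷ ws) u v = Via ws u v ⊎ (Via ws u w × Via ws w v)

    Via-refl : ∀ ws {u} → Via ws u u
    Via-refl []       = inj₁ refl
    Via-refl (_ ∷ ws) = inj₁ (Via-refl ws)

    Via-edge : ∀ ws {u v} → E u v → Via ws u v
    Via-edge []       e = inj₂ e
    Via-edge (_ ∷ ws) e = inj₁ (Via-edge ws e)

    -- The head of the list has to be passed only once: when both halves pass through it, everything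
    -- between the two visits is cut out.
    Via-join : ∀ {ws w u v} → w ∈ₗ ws → Via ws u w → Via ws w v → Via ws u v
    Via-join (here refl)  (inj₁ p)       (inj₁ q)       = inj₂ (p , q)
    Via-join (here refl)  (inj₁ p)       (inj₂ (_ , q)) = inj₂ (p , q)
    Via-join (here refl)  (inj₂ (p , _)) (inj₁ q)       = inj₂ (p , q)
    Via-join (here refl)  (inj₂ (p , _)) (inj₂ (_ , q)) = inj₂ (p , q)
    Via-join (there w∈ws) (inj₁ p)       (inj₁ q)       = inj₁ (Via-join w∈ws p q)
    Via-join (there w∈ws) (inj₁ p)       (inj₂ (q , r)) = inj₂ (Via-join w∈ws p q , r)
    Via-join (there w∈ws) (inj₂ (p , q)) (inj₁ r)       = inj₂ (p , Via-join w∈ws q r)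
    Via-join (there w∈ws) (inj₂ (p , _)) (inj₂ (_ , r)) = inj₂ (p , r)

    Via⇒Star : ∀ ws {u v} → Via ws u v → Star E u v
    Via⇒Star []       (inj₁ refl)    = ε
    Via⇒Star []       (inj₂ e)       = e ◅ ε
    Via⇒Star (_ ∷ ws) (inj₁ p)       = Via⇒Star ws p
    Via⇒Star (_ ∷ ws) (inj₂ (p , q)) = Via⇒Star ws p ◅◅ Via⇒Star ws q

    Star⇒Via : ∀ {u v} → Star E u v → Via (allFin n) u v
    Star⇒Via ε        = Via-refl (allFin n)
    Star⇒Via (e ◅ es) = Via-join (∈-allFin _) (Via-edge (allFin n) e) (Star⇒Via es)

    star? : Decidable E → Decidable (Star E)
    star? E? u v = map′ (Via⇒Star (allFin n)) Star⇒Via (via? (allFin n) u v)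
      where
      via? : ∀ ws → Decidable (Via ws)
      via? []       u v = (u ≟ v) ⊎-dec E? u v
      via? (w ∷ ws) u v = via? ws u v ⊎-dec (via? ws u w ×-dec via? ws w v)

  -- Counting equivalence classes by reciprocals of their sizes.

  module _ {n} {R : Rel (Fin n) 0ℓ} (R? : Decidable R) where

    classSize : {P : Fin n → Set} → (∀ i → Dec (P i)) → Fin n → ℚ
    classSize P? u = ∑ (λ x → ⟦ P? x ⟧ * ⟦ R? u x ⟧)

    classSize>0 : {P : Fin n → Set} (P? : ∀ i → Dec (P i)) → ∀ {u t} → P t → R u t → 0ℚ < classSize P? u
    classSize>0 P? {u} {t} pt rut = ∑-pos _ (λ x → *-nonneg (0≤⟦⟧ (P? x)) (0≤⟦⟧ (R? u x))) t
      (subst (0ℚ <_) (sym (trans (⟦⟧-yes* (P? t) _ pt) (⟦⟧-yes (R? u t) rut))) (ℚ.positive⁻¹ 1ℚ))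

    module _ (R-sym : Symmetric R) (R-trans : Transitive R) where

      classSize-cong : {P : Fin n → Set} (P? : ∀ i → Dec (P i)) → ∀ {u v} → R u v →
                       classSize P? u ≡ classSize P? v
      classSize-cong P? {u} {v} ruv = ∑-cong (λ x → cong (⟦ P? x ⟧ *_)
        (⟦⟧-cong (R? u x) (R? v x) (R-trans (R-sym ruv)) (R-trans ruv)))

      private
        -- A class with p > 0 members in `P` and q > 0 members in `Q` contains pq pairs, each of
        -- weight 1/(pq), and so contributes 1. The expression is symmetric in `P` and `Q`, which is
        -- what `class-count` exploits.
        pairs : {P Q : Fin n → Set} → (∀ i → Dec (P i)) → (∀ i → Dec (Q i)) → ℚ
        pairs P? Q? = ∑ (λ u → ∑ (λ t →
          ⟦ P? u ⟧ * (⟦ Q? t ⟧ * (⟦ R? u t ⟧ * (inv (classSize P? u) * inv (classSize Q? t))))))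

        pairs-comm : {P Q : Fin n → Set} (P? : ∀ i → Dec (P i)) (Q? : ∀ i → Dec (Q i)) →
                     pairs P? Q? ≡ pairs Q? P?
        pairs-comm P? Q? = trans (∑-comm (λ u t → ⟦ P? u ⟧ * (⟦ Q? t ⟧ * (⟦ R? u t ⟧ * (inv (classSize P? u) * inv (classSize Q? t)))))) (∑-cong λ t → ∑-cong λ u → begin
          ⟦ P? u ⟧ * (⟦ Q? t ⟧ * (⟦ R? u t ⟧ * (inv (classSize P? u) * inv (classSize Q? t))))
            ≡⟨ cong (λ r → ⟦ P? u ⟧ * (⟦ Q? t ⟧ * (r * (inv (classSize P? u) * inv (classSize Q? t))))) (⟦⟧-cong (R? u t) (R? t u) R-sym R-sym) ⟩
          ⟦ P? u ⟧ * (⟦ Q? t ⟧ * (⟦ R? t u ⟧ * (inv (classSize P? u) * inv (classSize Q? t))))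
            ≡⟨ solve 5 (λ p q r i j → p :* (q :* (r :* (i :* j))) := q :* (p :* (r :* (j :* i)))) refl
                 ⟦ P? u ⟧ ⟦ Q? t ⟧ ⟦ R? t u ⟧ (inv (classSize P? u)) (inv (classSize Q? t)) ⟩
          ⟦ Q? t ⟧ * (⟦ P? u ⟧ * (⟦ R? t u ⟧ * (inv (classSize Q? t) * inv (classSize P? u)))) ∎)
          where open ≡-Reasoning

        -- The factor 1 = b · `inv b`, where b is the number of members of `Q` in the class of u,
        -- spreads the term of u evenly over these members; `hit` guarantees that b is not 0.
        sum-inv≡pairs : {P Q : Fin n → Set} (P? : ∀ i → Dec (P i)) (Q? : ∀ i → Dec (Q i)) →
                        (∀ u → P u → ∃ λ t → Q t × R u t) →
                        ∑ (λ u → ⟦ P? u ⟧ * inv (classSize P? u)) ≡ pairs P? Q?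
        sum-inv≡pairs P? Q? hit = ∑-cong λ u →
          trans (⟦⟧*-cong (P? u) (step u)) (*-∑ ⟦ P? u ⟧ (λ t → ⟦ Q? t ⟧ * (⟦ R? u t ⟧ * (inv (classSize P? u) * inv (classSize Q? t)))))
          where
          open ≡-Reasoning
          step : ∀ u → _ → inv (classSize P? u) ≡
                 ∑ (λ t → ⟦ Q? t ⟧ * (⟦ R? u t ⟧ * (inv (classSize P? u) * inv (classSize Q? t))))
          step u pu = begin
            a                                          ≡⟨ ℚ.*-identityˡ a ⟨
            1ℚ * a                                     ≡⟨ cong (_* a) (*-inv (<⇒≢0 0<b)) ⟨
            (b * inv b) * a                            ≡⟨ solve 3 (λ b i a → (b :* i) :* a := b :* (a :* i)) refl b (inv b) a ⟩
            b * (a * inv b)                            ≡⟨ ∑-* (a * inv b) (λ t → ⟦ Q? t ⟧ * ⟦ R? u t ⟧) ⟩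
            ∑ (λ t → (⟦ Q? t ⟧ * ⟦ R? u t ⟧) * (a * inv b))
              ≡⟨ ∑-cong (λ t → trans (ℚ.*-assoc ⟦ Q? t ⟧ ⟦ R? u t ⟧ (a * inv b)) (cong (⟦ Q? t ⟧ *_)
                   (⟦⟧*-cong (R? u t) (λ rut → cong (λ c → a * inv c) (classSize-cong Q? rut))))) ⟩
            ∑ (λ t → ⟦ Q? t ⟧ * (⟦ R? u t ⟧ * (a * inv (classSize Q? t)))) ∎
            where
            a b : ℚ
            a = inv (classSize P? u)
            b = classSize Q? u
            0<b : 0ℚ < b
            0<b = let t , qt , rut = hit u pu in classSize>0 Q? qt rut

      -- Both sides count the classes met by P, equivalently by Q.
      class-count : {P Q : Fin n → Set} (P? : ∀ i → Dec (P i)) (Q? : ∀ i → Dec (Q i)) →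
                    (∀ u → P u → ∃ λ t → Q t × R u t) →
                    (∀ t → Q t → ∃ λ u → P u × R t u) →
                    ∑ (λ u → ⟦ P? u ⟧ * inv (classSize P? u)) ≡
                    ∑ (λ t → ⟦ Q? t ⟧ * inv (classSize Q? t))
      class-count P? Q? P⇒Q Q⇒P = begin
        ∑ (λ u → ⟦ P? u ⟧ * inv (classSize P? u))  ≡⟨ sum-inv≡pairs P? Q? P⇒Q ⟩
        pairs P? Q?                                ≡⟨ pairs-comm P? Q? ⟩
        pairs Q? P?                                ≡⟨ sum-inv≡pairs Q? P? Q⇒P ⟨
        ∑ (λ t → ⟦ Q? t ⟧ * inv (classSize Q? t))  ∎
        where open ≡-Reasoning

  -- Connectivity in subgraphs and under vertex deletion.

  module _ {n} {G : Graph n} where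

    open Subgraph

    Edge-≢ : (H : Subgraph G) → ∀ {u v} → Edge H u v → u ≢ v
    Edge-≢ H e u≡v = Graph.irrefl G u≡v (Edge⇒Adj H e)

    Edge⇒∈′ : (H : Subgraph G) → ∀ {u v} → Edge H u v → v ∈ vertices H
    Edge⇒∈′ H e = Edge⇒∈ H (Edge-sym H e)

    ∈-delete⁻ : (H : Subgraph G) → ∀ {w x} → x ∈ vertices (delete H w) → x ∈ vertices H × x ≢ w
    ∈-delete⁻ H {w} {x} x∈ = p─q⊆p (vertices H) ⁅ w ⁆ x∈ , λ { refl → x∈p─q⇒x∉q (vertices H) ⁅ w ⁆ x∈ (x∈⁅x⁆ w) }

    ∈-delete⁺ : (H : Subgraph G) → ∀ {w x} → x ∈ vertices H → x ≢ w → x ∈ vertices (delete H w)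
    ∈-delete⁺ H = x∈p∧x≢y⇒x∈p-y

    Conn : Subgraph G → Rel (Fin n) 0ℓ
    Conn H = Star (Edge H)

    Conn? : (H : Subgraph G) → Decidable (Conn H)
    Conn? H = star? (Edge? H)

    Conn-sym : (H : Subgraph G) → Symmetric (Conn H)
    Conn-sym H = Star-reverse (Edge-sym H)

    Conn-delete⊆ : (H : Subgraph G) → ∀ {w u v} → Conn (delete H w) u v → Conn H u v
    Conn-delete⊆ H = Star-map proj₁

    -- The walk is cut at its first arrival at `w`, and `t` is the vertex just before. Hence every
    -- part into which the component of `w` splits contains a neighbour of `w`.
    last-exit : (H : Subgraph G) → ∀ {w u} → Conn H u w → u ≢ w → ∃ λ t → Edge H t w × Conn (delete H w) u t
    last-exit H ε u≢u = contradiction refl u≢u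
    last-exit H {w} {u} (_◅_ {j = b} e p) u≢w with b ≟ w
    ... | yes refl = u , e , ε
    ... | no b≢w   = let t , e′ , q = last-exit H p b≢w in t , e′ , (e , u≢w , b≢w) ◅ q

    avoids : (H : Subgraph G) → ∀ {w u v} → ¬ Conn H u w → Conn H u v → Conn (delete H w) u v
    avoids H u≁w ε = ε
    avoids H u≁w (e ◅ p) = (e , (λ { refl → u≁w ε }) , (λ { refl → u≁w (e ◅ ε) })) ◅ avoids H (u≁w ∘ (e ◅_)) p

    -- The quantities entering the gap.

    V : Subgraph G → Fin n → ℚ
    V H u = ⟦ u ∈? vertices H ⟧

    E : Subgraph G → Fin n → Fin n → ℚ
    E H u v = ⟦ Edge? H u v ⟧

    order : Subgraph G → ℚ
    order H = ∑ (V H)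

    -- Common neighbours are counted inside `H`, not inside `G`, so that deleting one of them lowers
    -- the count.
    codeg : Subgraph G → Fin n → Fin n → ℚ
    codeg H u v = ∑ (λ w → E H u w * E H v w)

    -- `i₂` is the weight of an edge, and `i₁` is the weight that it acquires when one common
    -- neighbour of its ends is deleted.
    i₁ i₂ : Subgraph G → Fin n → Fin n → ℚ
    i₁ H u v = inv (1ℚ + codeg H u v)
    i₂ H u v = inv (1ℚ + 1ℚ + codeg H u v)

    pairSum : Subgraph G → ℚ
    pairSum H = ∑ (λ u → ∑ (λ v → E H u v * i₂ H u v))

    compSize : (H : Subgraph G) → Fin n → ℚ
    compSize H = classSize (Conn? H) (_∈? vertices H)

    -- The number of components, each vertex contributing the reciprocal of the size of its component.
    comps : Subgraph G → ℚ
    comps H = ∑ (λ u → V H u * inv (compSize H u))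

    gap : Subgraph G → ℚ
    gap H = pairSum H + comps H - order H

    near : Subgraph G → Fin n → ℚ
    near H w = ∑ (λ x → E H x w * i₁ H x w)

    -- The m(x) of the header, so that far H w is the number of parts into which the component of w splits.
    nbrs : (H : Subgraph G) → Fin n → Fin n → ℚ
    nbrs H w = classSize (Conn? (delete H w)) (λ y → Edge? H y w)

    far : Subgraph G → Fin n → ℚ
    far H w = ∑ (λ x → E H x w * inv (nbrs H w x))

    0≤codeg : (H : Subgraph G) → ∀ u v → 0ℚ ≤ codeg H u v
    0≤codeg H u v = ∑-nonneg _ (λ w → *-nonneg (0≤⟦⟧ (Edge? H u w)) (0≤⟦⟧ (Edge? H v w)))

    -- The effect of deleting a vertex on order, edge weights and components.

    order-delete : (H : Subgraph G) → ∀ {w} → w ∈ vertices H → order (delete H w) ≡ order H - 1ℚ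
    order-delete H {w} w∈H = trans
      (trans (∑-cong (λ u → split u (u ≟ w))) (∑-minus (V H) (λ u → ⟦ u ≟ w ⟧)))
      (cong (order H -_) (∑-δ w))
      where
      split : ∀ u (d : Dec (u ≡ w)) → V (delete H w) u ≡ V H u - ⟦ d ⟧
      split u (yes refl) = trans (⟦⟧-no (w ∈? vertices (delete H w)) (λ w∈ → proj₂ (∈-delete⁻ H w∈) refl))
                             (cong (_- 1ℚ) (sym (⟦⟧-yes (w ∈? vertices H) w∈H)))
      split u (no u≢w) = trans (⟦⟧-cong (u ∈? vertices (delete H w)) (u ∈? vertices H) (proj₁ ∘ ∈-delete⁻ H) (λ u∈ → ∈-delete⁺ H u∈ u≢w))
                             (sym (ℚ.+-identityʳ (V H u)))

    codeg-delete : (H : Subgraph G) → ∀ {w u v} → u ≢ w → v ≢ w →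
                   codeg (delete H w) u v ≡ codeg H u v - E H u w * E H v w
    codeg-delete H {w} {u} {v} u≢w v≢w = trans
      (trans (∑-cong (λ z → split z (z ≟ w))) (∑-minus _ _))
      (cong (codeg H u v -_) (∑-diag (λ z → E H u z * E H v z) w))
      where
      split : ∀ z (d : Dec (z ≡ w)) → E (delete H w) u z * E (delete H w) v z ≡
                        E H u z * E H v z - ⟦ d ⟧ * (E H u z * E H v z)
      split z (yes refl) = trans (⟦⟧-no* (Edge? (delete H z) u z) (E (delete H w) v z) (λ (_ , _ , z≢z) → z≢z refl))
                             (solve 1 (λ x → con 0ℚ := x :- con 1ℚ :* x) refl (E H u z * E H v z))
      split z (no z≢w)   = trans (⟦⟧*⟦⟧-cong (Edge? (delete H w) u z) (Edge? (delete H w) v z) (Edge? H u z) (Edge? H v z)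
                                (λ (e , _) (f , _) → e , f) (λ e f → (e , u≢w , z≢w) , (f , v≢w , z≢w)))
                             (solve 1 (λ x → x := x :- con 0ℚ :* x) refl (E H u z * E H v z))

    -- After interchanging the sums, fix an edge uv with c common neighbours. Among the |H|
    -- deletions, those of u and v destroy the edge, c raise its weight to 1/(c+1), and |H|-2-c
    -- leave it at 1/(c+2). The total is |H|/(c+2) - 1/(c+1).
    pairSum-delete : (H : Subgraph G) →
      ∑ (λ w → V H w * pairSum (delete H w)) ≡ order H * pairSum H - ∑ (near H)
    pairSum-delete H = begin
      ∑ (λ w → V H w * pairSum (delete H w))
        ≡⟨ ∑-cong (λ w → trans (*-∑ (V H w) _) (∑-cong (λ u → *-∑ (V H w) _))) ⟩
      ∑ (λ w → ∑ (λ u → ∑ (λ v → t w u v)))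
        ≡⟨ ∑-comm (λ w u → ∑ (λ v → t w u v)) ⟩
      ∑ (λ u → ∑ (λ w → ∑ (λ v → t w u v)))
        ≡⟨ ∑-cong (λ u → ∑-comm (λ w v → t w u v)) ⟩
      ∑ (λ u → ∑ (λ v → ∑ (λ w → t w u v)))
        ≡⟨ ∑-cong (λ u → trans (∑-cong (λ v → edge u v)) (trans (∑-minus _ _) (cong (_- ∑ (λ v → E H u v * i₁ H u v)) (sym (*-∑ (order H) _))))) ⟩
      ∑ (λ u → order H * ∑ (λ v → E H u v * i₂ H u v) - ∑ (λ v → E H u v * i₁ H u v))
        ≡⟨ trans (∑-minus _ _) (cong₂ _-_ (sym (*-∑ (order H) _)) (∑-comm (λ u v → E H u v * i₁ H u v))) ⟩
      order H * pairSum H - ∑ (near H) ∎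
      where
      open ≡-Reasoning
      t : Fin n → Fin n → Fin n → ℚ
      t w u v = V H w * (E (delete H w) u v * i₂ (delete H w) u v)

      -- For an edge uv this is `t` with the case distinction on w turned into a linear expression
      -- in indicators, which can be summed over w term by term.
      a : Fin n → Fin n → Fin n → ℚ
      a w u v = (V H w - ⟦ w ≟ u ⟧ - ⟦ w ≟ v ⟧) * i₂ H u v + (E H u w * E H v w) * (i₁ H u v - i₂ H u v)

      vanish : ∀ x y i j → x ≡ 0ℚ → y ≡ 0ℚ → 0ℚ ≡ x * i + y * j
      vanish _ _ i j refl refl = solve 2 (λ i j → con 0ℚ := con 0ℚ :* i :+ con 0ℚ :* j) refl i j

      term : ∀ w u v → Edge H u v → t w u v ≡ a w u v
      term w u v e = cases w (w ≟ u) (w ≟ v) (w ∈? vertices H)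
        where
        isolated : ∀ x → E H x x ≡ 0ℚ
        isolated x = ⟦⟧-no (Edge? H x x) (λ e′ → Edge-≢ H e′ refl)
        cases : ∀ w (d : Dec (w ≡ u)) (d′ : Dec (w ≡ v)) (d″ : Dec (w ∈ vertices H)) →
          ⟦ d″ ⟧ * (E (delete H w) u v * i₂ (delete H w) u v) ≡
          (⟦ d″ ⟧ - ⟦ d ⟧ - ⟦ d′ ⟧) * i₂ H u v + (E H u w * E H v w) * (i₁ H u v - i₂ H u v)
        cases _ (yes refl) (yes u≡v) _ = contradiction u≡v (Edge-≢ H e)
        cases _ (yes refl) _ (no u∉H) = contradiction (Edge⇒∈ H e) u∉H
        cases _ _ (yes refl) (no v∉H) = contradiction (Edge⇒∈′ H e) v∉H
        cases w (yes refl) (no _) (yes _) = trans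
          (trans (ℚ.*-identityˡ (E (delete H w) w v * i₂ (delete H w) w v))
                 (⟦⟧-no* (Edge? (delete H w) w v) (i₂ (delete H w) w v) (λ (_ , w≢w , _) → w≢w refl)))
          (vanish (1ℚ - 1ℚ - 0ℚ) (E H w w * E H v w) (i₂ H w v) (i₁ H w v - i₂ H w v)
            refl (trans (cong (_* E H v w) (isolated w)) (ℚ.*-zeroˡ (E H v w))))
        cases w (no _) (yes refl) (yes _) = trans
          (trans (ℚ.*-identityˡ (E (delete H w) u w * i₂ (delete H w) u w))
                 (⟦⟧-no* (Edge? (delete H w) u w) (i₂ (delete H w) u w) (λ (_ , _ , w≢w) → w≢w refl)))
          (vanish (1ℚ - 0ℚ - 1ℚ) (E H u w * E H w w) (i₂ H u w) (i₁ H u w - i₂ H u w)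
            refl (trans (cong (E H u w *_) (isolated w)) (ℚ.*-zeroʳ (E H u w))))
        cases w (no _) (no _) (no w∉H) = trans
          (ℚ.*-zeroˡ (E (delete H w) u v * i₂ (delete H w) u v))
          (vanish (0ℚ - 0ℚ - 0ℚ) (E H u w * E H v w) (i₂ H u v) (i₁ H u v - i₂ H u v)
            refl (⟦⟧-no* (Edge? H u w) (E H v w) (w∉H ∘ Edge⇒∈′ H)))
        cases w (no w≢u) (no w≢v) (yes _) = begin
          1ℚ * (E (delete H w) u v * i₂ (delete H w) u v)
            ≡⟨ trans (ℚ.*-identityˡ (E (delete H w) u v * i₂ (delete H w) u v)) (⟦⟧-yes* (Edge? (delete H w) u v) _ (e , u≢w , v≢w)) ⟩
          inv (1ℚ + 1ℚ + codeg (delete H w) u v)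
            ≡⟨ cong (λ c → inv (1ℚ + 1ℚ + c)) (codeg-delete H u≢w v≢w) ⟩
          inv (1ℚ + 1ℚ + (codeg H u v - E H u w * E H v w))
            ≡⟨ final (Edge? H u w) (Edge? H v w) ⟩
          (1ℚ - 0ℚ - 0ℚ) * i₂ H u v + (E H u w * E H v w) * (i₁ H u v - i₂ H u v) ∎
          where
          u≢w : u ≢ w
          u≢w = w≢u ∘ sym
          v≢w : v ≢ w
          v≢w = w≢v ∘ sym
          c : ℚ
          c = codeg H u v
          unchanged : ∀ p → p ≡ 0ℚ → inv (1ℚ + 1ℚ + (c - p)) ≡ (1ℚ - 0ℚ - 0ℚ) * inv (1ℚ + 1ℚ + c) + p * (inv (1ℚ + c) - inv (1ℚ + 1ℚ + c))
          unchanged p refl = trans (cong inv (solve 1 (λ c → con 1ℚ :+ con 1ℚ :+ (c :- con 0ℚ) := con 1ℚ :+ con 1ℚ :+ c) refl c))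
            (solve 2 (λ i j → j := (con 1ℚ :- con 0ℚ :- con 0ℚ) :* j :+ con 0ℚ :* (i :- j)) refl (inv (1ℚ + c)) (inv (1ℚ + 1ℚ + c)))
          final : {P Q : Set} (p : Dec P) (q : Dec Q) → inv (1ℚ + 1ℚ + (c - ⟦ p ⟧ * ⟦ q ⟧)) ≡
                  (1ℚ - 0ℚ - 0ℚ) * inv (1ℚ + 1ℚ + c) + (⟦ p ⟧ * ⟦ q ⟧) * (inv (1ℚ + c) - inv (1ℚ + 1ℚ + c))
          final (yes _) (yes _) = trans (cong inv (solve 1 (λ c → con 1ℚ :+ con 1ℚ :+ (c :- con 1ℚ) := con 1ℚ :+ c) refl c))
            (solve 2 (λ i j → i := (con 1ℚ :- con 0ℚ :- con 0ℚ) :* j :+ con 1ℚ :* (i :- j)) refl (inv (1ℚ + c)) (inv (1ℚ + 1ℚ + c)))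
          final (yes _) (no _)  = unchanged 0ℚ refl
          final (no _)  q       = unchanged (0ℚ * ⟦ q ⟧) (ℚ.*-zeroˡ ⟦ q ⟧)

      ∑a : ∀ u v → ∑ (λ w → a w u v) ≡ order H * i₂ H u v - i₁ H u v
      ∑a u v = begin
        ∑ (λ w → a w u v)
          ≡⟨ ∑-+ (λ w → (V H w - ⟦ w ≟ u ⟧ - ⟦ w ≟ v ⟧) * j) (λ w → (E H u w * E H v w) * (i - j)) ⟩
        ∑ (λ w → (V H w - ⟦ w ≟ u ⟧ - ⟦ w ≟ v ⟧) * j) + ∑ (λ w → (E H u w * E H v w) * (i - j))
          ≡⟨ cong₂ _+_ (sym (∑-* j (λ w → V H w - ⟦ w ≟ u ⟧ - ⟦ w ≟ v ⟧))) (sym (∑-* (i - j) (λ w → E H u w * E H v w))) ⟩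
        ∑ (λ w → V H w - ⟦ w ≟ u ⟧ - ⟦ w ≟ v ⟧) * j + c * (i - j)
          ≡⟨ cong (λ s → s * j + c * (i - j)) (trans (∑-minus (λ w → V H w - ⟦ w ≟ u ⟧) (λ w → ⟦ w ≟ v ⟧))
               (cong₂ _-_ (trans (∑-minus (V H) (λ w → ⟦ w ≟ u ⟧)) (cong (order H -_) (∑-δ u))) (∑-δ v))) ⟩
        (order H - 1ℚ - 1ℚ) * j + c * (i - j)
          -- The regrouping isolates (1+c)·i - (2+c)·j, which is 1 - 1. This cancellation is where
          -- the constant 2 in the weight is used.
          ≡⟨ solve 4 (λ o c i j → (o :- con 1ℚ :- con 1ℚ) :* j :+ c :* (i :- j)
                         := (o :* j :- i) :+ ((con 1ℚ :+ c) :* i :- (con 1ℚ :+ con 1ℚ :+ c) :* j)) refl (order H) c i j ⟩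
        (order H * j - i) + ((1ℚ + c) * i - (1ℚ + 1ℚ + c) * j)
          ≡⟨ cong (λ s → (order H * j - i) + s) (cong₂ _-_ (*-inv (<⇒≢0 (+-pos 0<1 0≤c))) (*-inv (<⇒≢0 (+-pos (+-pos 0<1 (ℚ.<⇒≤ 0<1)) 0≤c)))) ⟩
        (order H * j - i) + 0ℚ
          ≡⟨ ℚ.+-identityʳ (order H * j - i) ⟩
        order H * j - i ∎
        where
        c i j : ℚ
        c = codeg H u v
        i = i₁ H u v
        j = i₂ H u v
        0≤c : 0ℚ ≤ c
        0≤c = 0≤codeg H u v

      edge : ∀ u v → ∑ (λ w → t w u v) ≡ order H * (E H u v * i₂ H u v) - E H u v * i₁ H u v
      edge u v = begin
        ∑ (λ w → t w u v)                      ≡⟨ ∑-cong factor ⟩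
        ∑ (λ w → E H u v * t w u v)            ≡⟨ *-∑ (E H u v) (λ w → t w u v) ⟨
        E H u v * ∑ (λ w → t w u v)            ≡⟨ ⟦⟧*-cong (Edge? H u v) (λ e → trans (∑-cong (λ w → term w u v e)) (∑a u v)) ⟩
        E H u v * (order H * i₂ H u v - i₁ H u v)
          ≡⟨ solve 4 (λ e o i j → e :* (o :* j :- i) := o :* (e :* j) :- e :* i) refl (E H u v) (order H) (i₁ H u v) (i₂ H u v) ⟩
        order H * (E H u v * i₂ H u v) - E H u v * i₁ H u v ∎
        where
        -- An edge of `delete H w` is an edge of `H`, so its indicator in `H` may be inserted; then
        -- `term` has to be known for edges only.
        factor : ∀ w → t w u v ≡ E H u v * t w u v
        factor w = begin
          V H w * (E (delete H w) u v * i₂ (delete H w) u v)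
            ≡⟨ cong (λ e → V H w * (e * i₂ (delete H w) u v)) (sym (⟦⟧-absorb (Edge? H u v) (Edge? (delete H w) u v) proj₁)) ⟩
          V H w * (E H u v * E (delete H w) u v * i₂ (delete H w) u v)
            ≡⟨ solve 4 (λ x e f i → x :* (e :* f :* i) := e :* (x :* (f :* i))) refl (V H w) (E H u v) (E (delete H w) u v) (i₂ (delete H w) u v) ⟩
          E H u v * t w u v ∎

    -- The sums are split at the component of `w`. Components that miss `w` keep their vertices and
    -- sizes. The component of `w` counts 1 before the deletion and afterwards the number of its
    -- parts, which the neighbours of `w` can count because each part contains one of them.
    comps-delete : (H : Subgraph G) → ∀ {w} → w ∈ vertices H →
                   far H w + comps H ≡ 1ℚ + comps (delete H w)
    comps-delete H {w} w∈H = begin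
      far H w + comps H         ≡⟨ cong (far H w +_) (split H) ⟩
      far H w + (own + others)  ≡⟨ cong (λ s → far H w + (s + others)) own≡1 ⟩
      far H w + (1ℚ + others)   ≡⟨ solve 2 (λ f o → f :+ (con 1ℚ :+ o) := con 1ℚ :+ (f :+ o)) refl (far H w) others ⟩
      1ℚ + (far H w + others)   ≡⟨ cong (1ℚ +_) (cong₂ _+_ (sym own′≡far) others≡) ⟩
      1ℚ + (∑ (λ u → ⟦ Conn? H u w ⟧ * (V H′ u * inv (compSize H′ u))) +
            ∑ (λ u → ⟦ ¬? (Conn? H u w) ⟧ * (V H′ u * inv (compSize H′ u))))
                                ≡⟨ cong (1ℚ +_) (split H′) ⟨
      1ℚ + comps H′             ∎
      where
      open ≡-Reasoning
      H′ : Subgraph G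
      H′ = delete H w

      own others : ℚ
      own    = ∑ (λ u → ⟦ Conn? H u w ⟧ * (V H u * inv (compSize H u)))
      others = ∑ (λ u → ⟦ ¬? (Conn? H u w) ⟧ * (V H u * inv (compSize H u)))

      split : (K : Subgraph G) → comps K ≡
        ∑ (λ u → ⟦ Conn? H u w ⟧ * (V K u * inv (compSize K u))) +
        ∑ (λ u → ⟦ ¬? (Conn? H u w) ⟧ * (V K u * inv (compSize K u)))
      split K = trans (∑-cong (λ u → ⟦⟧-split (Conn? H u w) (V K u * inv (compSize K u)))) (∑-+ _ _)

      own≡1 : own ≡ 1ℚ
      own≡1 = begin
        own
          ≡⟨ ∑-cong (λ u → ⟦⟧*-cong (Conn? H u w) (λ u~w →
               cong (λ s → V H u * inv s) (classSize-cong (Conn? H) (Conn-sym H) _◅◅_ (_∈? vertices H) u~w))) ⟩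
        ∑ (λ u → ⟦ Conn? H u w ⟧ * (V H u * inv (compSize H w)))
          ≡⟨ ∑-cong (λ u → trans
               (cong (_* (V H u * inv (compSize H w))) (⟦⟧-cong (Conn? H u w) (Conn? H w u) (Conn-sym H) (Conn-sym H)))
               (solve 3 (λ c v i → c :* (v :* i) := (v :* c) :* i) refl ⟦ Conn? H w u ⟧ (V H u) (inv (compSize H w)))) ⟩
        ∑ (λ u → (V H u * ⟦ Conn? H w u ⟧) * inv (compSize H w))
          ≡⟨ ∑-* (inv (compSize H w)) (λ u → V H u * ⟦ Conn? H w u ⟧) ⟨
        compSize H w * inv (compSize H w)
          ≡⟨ *-inv (<⇒≢0 (classSize>0 (Conn? H) (_∈? vertices H) w∈H ε)) ⟩
        1ℚ ∎

      others≡ : others ≡ ∑ (λ u → ⟦ ¬? (Conn? H u w) ⟧ * (V H′ u * inv (compSize H′ u)))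
      others≡ = ∑-cong (λ u → ⟦⟧*-cong (¬? (Conn? H u w)) (λ u≁w → cong₂ (λ v s → v * inv s)
        (⟦⟧-cong (u ∈? vertices H) (u ∈? vertices H′) (λ u∈H → ∈-delete⁺ H u∈H (λ { refl → u≁w ε })) (proj₁ ∘ ∈-delete⁻ H))
        (∑-cong (λ x → ⟦⟧*⟦⟧-cong (x ∈? vertices H) (Conn? H u x) (x ∈? vertices H′) (Conn? H′ u x)
          (λ x∈H u~x → ∈-delete⁺ H x∈H (λ { refl → u≁w u~x }) , avoids H u≁w u~x)
          (λ x∈H′ u~x → proj₁ (∈-delete⁻ H x∈H′) , Conn-delete⊆ H u~x)))))

      Own? : ∀ u → Dec (Conn H u w × u ∈ vertices H′)
      Own? u = Conn? H u w ×-dec (u ∈? vertices H′)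

      own′≡far : ∑ (λ u → ⟦ Conn? H u w ⟧ * (V H′ u * inv (compSize H′ u))) ≡ far H w
      own′≡far = begin
        ∑ (λ u → ⟦ Conn? H u w ⟧ * (V H′ u * inv (compSize H′ u)))
          ≡⟨ ∑-cong (λ u → ⟦⟧*-cong (Conn? H u w) (λ u~w → cong (λ s → V H′ u * inv s)
               (∑-cong (λ x → ⟦⟧*⟦⟧-cong (x ∈? vertices H′) (Conn? H′ u x) (Own? x) (Conn? H′ u x)
                 (λ x∈H′ u~x → (Conn-sym H (Conn-delete⊆ H u~x) ◅◅ u~w , x∈H′) , u~x)
                 (λ (_ , x∈H′) u~x → x∈H′ , u~x))))) ⟩
        ∑ (λ u → ⟦ Conn? H u w ⟧ * (V H′ u * inv (classSize (Conn? H′) Own? u)))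
          ≡⟨ ∑-cong (λ u → trans (sym (ℚ.*-assoc ⟦ Conn? H u w ⟧ (V H′ u) (inv (classSize (Conn? H′) Own? u))))
               (cong (_* inv (classSize (Conn? H′) Own? u)) (sym (⟦⟧-× (Conn? H u w) (u ∈? vertices H′))))) ⟩
        ∑ (λ u → ⟦ Own? u ⟧ * inv (classSize (Conn? H′) Own? u))
          -- The two families are the vertices of the component of `w` other than `w`, and the
          -- neighbours of `w`. The former reach a neighbour by `last-exit`; each neighbour belongs
          -- to the first family and represents itself.
          ≡⟨ class-count (Conn? H′) (Conn-sym H′) _◅◅_ Own? (λ y → Edge? H y w)
               (λ u (u~w , u∈H′) → last-exit H u~w (proj₂ (∈-delete⁻ H u∈H′)))
               (λ t e → t , (e ◅ ε , ∈-delete⁺ H (Edge⇒∈ H e) (Edge-≢ H e)) , ε) ⟩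
        far H w ∎

    -- The local estimate at an edge, and when it is sharp.

    module _ (H : Subgraph G) {w x} (x–w : Edge H x w) where

      -- This marks the neighbours of `w` in the part of `x` that are neither `x` nor adjacent to
      -- `x`. In this form the sum is m(x) - (c(xw)+1), so non-negative terms give the estimate and
      -- vanishing terms its equality case.
      excess : Fin n → ℚ
      excess y = E H y w * (⟦ Conn? (delete H w) x y ⟧ - (⟦ y ≟ x ⟧ + E H x y))

      ∑-excess : ∑ excess ≡ nbrs H w x - (1ℚ + codeg H x w)
      ∑-excess = begin
        ∑ excess
          ≡⟨ ∑-cong (λ y → trans
               (solve 4 (λ e c d f → e :* (c :- (d :+ f)) := e :* c :- (d :* e :+ f :* e)) refl (E H y w) ⟦ Conn? (delete H w) x y ⟧ ⟦ y ≟ x ⟧ (E H x y))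
               (cong (λ e → E H y w * ⟦ Conn? (delete H w) x y ⟧ - (⟦ y ≟ x ⟧ * E H y w + E H x y * e))
                 (⟦⟧-cong (Edge? H y w) (Edge? H w y) (Edge-sym H) (Edge-sym H)))) ⟩
        ∑ (λ y → E H y w * ⟦ Conn? (delete H w) x y ⟧ - (⟦ y ≟ x ⟧ * E H y w + E H x y * E H w y))
          ≡⟨ ∑-minus (λ y → E H y w * ⟦ Conn? (delete H w) x y ⟧) (λ y → ⟦ y ≟ x ⟧ * E H y w + E H x y * E H w y) ⟩
        nbrs H w x - ∑ (λ y → ⟦ y ≟ x ⟧ * E H y w + E H x y * E H w y)
          ≡⟨ cong (nbrs H w x -_) (trans (∑-+ (λ y → ⟦ y ≟ x ⟧ * E H y w) (λ y → E H x y * E H w y))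
               (cong (_+ codeg H x w) (trans (∑-diag (λ y → E H y w) x) (⟦⟧-yes (Edge? H x w) x–w)))) ⟩
        nbrs H w x - (1ℚ + codeg H x w) ∎
        where open ≡-Reasoning

      -- There are no loops, so the two alternatives exclude each other.
      near-or-equal : ∀ {y} (d : Dec (y ≡ x)) → ⟦ d ⟧ + E H x y ≡ ⟦ d ⊎-dec Edge? H x y ⟧
      near-or-equal (yes refl) = cong (1ℚ +_) (⟦⟧-no (Edge? H x x) (λ e → Edge-≢ H e refl))
      near-or-equal {y} d@(no y≢x) = trans (ℚ.+-identityˡ (E H x y))
        (⟦⟧-cong (Edge? H x y) (d ⊎-dec Edge? H x y) inj₂ λ { (inj₂ e) → e ; (inj₁ y≡x) → contradiction y≡x y≢x })

      near⇒Conn : ∀ {y} → Edge H y w → y ≡ x ⊎ Edge H x y → Conn (delete H w) x y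
      near⇒Conn y–w (inj₁ refl) = ε
      near⇒Conn y–w (inj₂ x–y)  = (x–y , Edge-≢ H x–w , Edge-≢ H y–w) ◅ ε

      0≤excess : ∀ y → 0ℚ ≤ excess y
      0≤excess y = ⟦⟧*-0≤ (Edge? H y w) λ y–w → p≤q⇒0≤q-p
        (subst (_≤ ⟦ Conn? (delete H w) x y ⟧) (sym (near-or-equal (y ≟ x)))
          (⟦⟧-mono ((y ≟ x) ⊎-dec Edge? H x y) (Conn? (delete H w) x y) (near⇒Conn y–w)))

      0<1+codeg : 0ℚ < 1ℚ + codeg H x w
      0<1+codeg = +-pos 0<1 (0≤codeg H x w)

      1+codeg≤nbrs : 1ℚ + codeg H x w ≤ nbrs H w x
      1+codeg≤nbrs = 0≤q-p⇒p≤q (subst (0ℚ ≤_) ∑-excess (∑-nonneg excess 0≤excess))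

      -- Equal reciprocals make the total excess 0, whereas a non-adjacent `y` would have excess 1.
      tight⇒ : i₁ H x w ≡ inv (nbrs H w x) → ∀ {y} → Edge H y w → x ≢ y → Conn (delete H w) x y → Edge H x y
      tight⇒ tight {y} y–w x≢y x~y with Edge? H x y
      ... | yes x–y = x–y
      ... | no ¬x–y = contradiction (sym (trans (sym one) (∑≡0⇒≡0 excess 0≤excess ∑≡0 y))) (<⇒≢0 0<1 ∘ sym)
        where
        ∑≡0 : ∑ excess ≡ 0ℚ
        ∑≡0 = trans ∑-excess (trans
          (cong (_- (1ℚ + codeg H x w)) (sym (inv-injective 0<1+codeg (ℚ.<-≤-trans 0<1+codeg 1+codeg≤nbrs) tight)))
          (p-p≡0 (1ℚ + codeg H x w)))
        one : excess y ≡ 1ℚ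
        one = begin
          excess y ≡⟨ ⟦⟧-yes* (Edge? H y w) _ y–w ⟩
          ⟦ Conn? (delete H w) x y ⟧ - (⟦ y ≟ x ⟧ + E H x y)
            ≡⟨ cong₂ _-_ (⟦⟧-yes (Conn? (delete H w) x y) x~y) (cong₂ _+_ (⟦⟧-no (y ≟ x) (x≢y ∘ sym)) (⟦⟧-no (Edge? H x y) ¬x–y)) ⟩
          1ℚ - (0ℚ + 0ℚ) ≡⟨⟩
          1ℚ ∎
          where open ≡-Reasoning

      ⇒tight : (∀ {y} → Edge H y w → x ≢ y → Conn (delete H w) x y → Edge H x y) → i₁ H x w ≡ inv (nbrs H w x)
      ⇒tight closed = cong inv (sym (p-q≡0⇒p≡q (nbrs H w x) (1ℚ + codeg H x w)
        (trans (sym ∑-excess) (∑-zero excess λ y → trans (⟦⟧*-cong (Edge? H y w) (zero-excess y)) (ℚ.*-zeroʳ (E H y w))))))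
        where
        zero-excess : ∀ y → Edge H y w → ⟦ Conn? (delete H w) x y ⟧ - (⟦ y ≟ x ⟧ + E H x y) ≡ 0ℚ
        zero-excess y y–w = trans
          (cong₂ _-_ (⟦⟧-cong (Conn? (delete H w) x y) ((y ≟ x) ⊎-dec Edge? H x y) (nearby (y ≟ x)) (near⇒Conn y–w))
                     (near-or-equal (y ≟ x)))
          (p-p≡0 ⟦ (y ≟ x) ⊎-dec Edge? H x y ⟧)
          where
          nearby : Dec (y ≡ x) → Conn (delete H w) x y → y ≡ x ⊎ Edge H x y
          nearby (yes y≡x) _   = inj₁ y≡x
          nearby (no y≢x)  x~y = inj₂ (closed y–w (y≢x ∘ sym) x~y)

    -- The recursion for the gap, its sign and its vanishing.

    slack : Subgraph G → Fin n → ℚ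
    slack H w = ∑ (λ x → E H x w * (i₁ H x w - inv (nbrs H w x)))

    slack-term : (H : Subgraph G) → ∀ w x → 0ℚ ≤ E H x w * (i₁ H x w - inv (nbrs H w x))
    slack-term H w x = ⟦⟧*-0≤ (Edge? H x w) (λ x–w → inv-antimono-≤ (0<1+codeg H x–w) (1+codeg≤nbrs H x–w))

    0≤slack : (H : Subgraph G) → ∀ w → 0ℚ ≤ slack H w
    0≤slack H w = ∑-nonneg _ (slack-term H w)

    slack≡ : (H : Subgraph G) → ∀ w → slack H w ≡ near H w - far H w
    slack≡ H w = trans
      (∑-cong (λ x → solve 3 (λ e i j → e :* (i :- j) := e :* i :- e :* j) refl (E H x w) (i₁ H x w) (inv (nbrs H w x))))
      (∑-minus _ _)

    -- The `near` part of the slack restores what `pairSum-delete` subtracts. The `far` part turns 1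
    -- + `comps (delete H w)` into `comps H`, where the 1 comes from the drop of the order.
    gap-delete : (H : Subgraph G) → order H * gap H ≡ ∑ (λ w → V H w * (gap (delete H w) + slack H w))
    gap-delete H = sym (begin
      ∑ (λ w → V H w * (gap (delete H w) + slack H w))
        ≡⟨ ∑-cong (λ w → trans (⟦⟧*-cong (w ∈? vertices H) (term w)) (expand w)) ⟩
      ∑ (λ w → (V H w * pairSum (delete H w) + near H w) + V H w * (k - o))
        ≡⟨ trans (∑-+ (λ w → V H w * pairSum (delete H w) + near H w) (λ w → V H w * (k - o)))
             (cong₂ _+_ (∑-+ (λ w → V H w * pairSum (delete H w)) (near H)) (sym (∑-* (k - o) (V H)))) ⟩
      (∑ (λ w → V H w * pairSum (delete H w)) + ∑ (near H)) + o * (k - o)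
        ≡⟨ cong (λ s → (s + ∑ (near H)) + o * (k - o)) (pairSum-delete H) ⟩
      ((o * pairSum H - ∑ (near H)) + ∑ (near H)) + o * (k - o)
        ≡⟨ solve 4 (λ o p k s → (o :* p :- s :+ s) :+ o :* (k :- o) := o :* (p :+ k :- o)) refl o (pairSum H) k (∑ (near H)) ⟩
      o * gap H ∎)
      where
      open ≡-Reasoning
      k o : ℚ
      k = comps H
      o = order H

      expand : ∀ w → V H w * ((pairSum (delete H w) + near H w) + (k - o)) ≡
                     (V H w * pairSum (delete H w) + near H w) + V H w * (k - o)
      expand w = trans
        (solve 4 (λ v p s t → v :* ((p :+ s) :+ t) := (v :* p :+ v :* s) :+ v :* t) refl (V H w) (pairSum (delete H w)) (near H w) (k - o))
        (cong (λ s → (V H w * pairSum (delete H w) + s) + V H w * (k - o)) (trans (*-∑ (V H w) (λ x → E H x w * i₁ H x w))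
          (∑-cong (λ x → trans (sym (ℚ.*-assoc (V H w) (E H x w) (i₁ H x w)))
            (cong (_* i₁ H x w) (⟦⟧-absorb (w ∈? vertices H) (Edge? H x w) (Edge⇒∈′ H)))))))

      term : ∀ w → w ∈ vertices H → gap (delete H w) + slack H w ≡ (pairSum (delete H w) + near H w) + (k - o)
      term w w∈H = begin
        gap (delete H w) + slack H w
          ≡⟨ cong₂ (λ q s → (p + k′ - q) + s) (order-delete H w∈H) (slack≡ H w) ⟩
        (p + k′ - (o - 1ℚ)) + (near H w - far H w)
          ≡⟨ solve 5 (λ p k′ o s f → (p :+ k′ :- (o :- con 1ℚ)) :+ (s :- f) := (p :+ s) :+ ((con 1ℚ :+ k′) :- f :- o)) refl p k′ o (near H w) (far H w) ⟩
        (p + near H w) + ((1ℚ + k′) - far H w - o)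
          ≡⟨ cong (λ q → (p + near H w) + (q - far H w - o)) (sym (comps-delete H w∈H)) ⟩
        (p + near H w) + ((far H w + k) - far H w - o)
          ≡⟨ cong (λ q → (p + near H w) + (q - o)) (solve 2 (λ f k → (f :+ k) :- f := k) refl (far H w) k) ⟩
        (p + near H w) + (k - o) ∎
        where
        p k′ : ℚ
        p = pairSum (delete H w)
        k′ = comps (delete H w)

    -- The equality condition; for G itself it says that every block is a clique.
    LocallyClosed : Subgraph G → Set
    LocallyClosed H = ∀ {w x y} → Edge H x w → Edge H y w → x ≢ y → Conn (delete H w) x y → Edge H x y

    -- A walk that avoids both deleted vertices is in particular a walk of `H` that avoids the
    -- common neighbour.
    LocallyClosed-delete : (H : Subgraph G) → ∀ {v} → LocallyClosed H → LocallyClosed (delete H v)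
    LocallyClosed-delete H loc (x–w , x≢v , w≢v) (y–w , y≢v , _) x≢y x~y =
      loc x–w y–w x≢y (Star-map (λ { ((e , _) , ≢w) → e , ≢w }) x~y) , x≢v , y≢v

    gap-empty : (H : Subgraph G) → ¬ Nonempty (vertices H) → gap H ≡ 0ℚ
    gap-empty H empty = cong₂ _-_
      (cong₂ _+_ (∑-zero _ (λ u → ∑-zero _ (λ v → ⟦⟧-no* (Edge? H u v) (i₂ H u v) (λ e → empty (u , Edge⇒∈ H e)))))
                 (∑-zero _ (λ u → ⟦⟧-no* (u ∈? vertices H) _ (λ u∈H → empty (u , u∈H)))))
      (∑-zero _ (λ u → ⟦⟧-no (u ∈? vertices H) (λ u∈H → empty (u , u∈H))))

    0<order : (H : Subgraph G) → Nonempty (vertices H) → 0ℚ < order H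
    0<order H (u , u∈H) = ∑-pos (V H) (λ w → 0≤⟦⟧ (w ∈? vertices H)) u
      (subst (0ℚ <_) (sym (⟦⟧-yes (u ∈? vertices H) u∈H)) 0<1)

    0≤gap-bounded : ∀ m (H : Subgraph G) → ∣ vertices H ∣ ℕ.< m → 0ℚ ≤ gap H
    0≤gap-bounded (ℕ.suc m) H (ℕ.s≤s ∣H∣≤m) with nonempty? (vertices H)
    ... | no empty = ℚ.≤-reflexive (sym (gap-empty H empty))
    ... | yes ne   = *-cancel-0≤ (0<order H ne) (subst (0ℚ ≤_) (sym (gap-delete H))
      (∑-nonneg _ λ w → ⟦⟧*-0≤ (w ∈? vertices H) λ w∈H →
        +-nonneg (0≤gap-bounded m (delete H w) (ℕ.<-≤-trans (x∈p⇒∣p-x∣<∣p∣ w∈H) ∣H∣≤m)) (0≤slack H w)))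

    0≤gap : (H : Subgraph G) → 0ℚ ≤ gap H
    0≤gap H = 0≤gap-bounded (ℕ.suc ∣ vertices H ∣) H ℕ.≤-refl

    -- `gap-delete` writes 0 as a sum of non-negative terms, so the slack of `H` vanishes at every
    -- vertex of `H`, and with it each of its summands.
    gap≡0⇒LocallyClosed : (H : Subgraph G) → gap H ≡ 0ℚ → LocallyClosed H
    gap≡0⇒LocallyClosed H gap≡0 {w} {x} x–w = tight⇒ H x–w (p-q≡0⇒p≡q (i₁ H x w) (inv (nbrs H w x))
      (trans (sym (⟦⟧-yes* (Edge? H x w) _ x–w)) (∑≡0⇒≡0 _ (slack-term H w) slack≡0 x)))
      where
      terms≡0 : ∀ v → V H v * (gap (delete H v) + slack H v) ≡ 0ℚ
      terms≡0 = ∑≡0⇒≡0 _ (λ v → *-nonneg (0≤⟦⟧ (v ∈? vertices H)) (+-nonneg (0≤gap (delete H v)) (0≤slack H v)))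
        (trans (sym (gap-delete H)) (trans (cong (order H *_) gap≡0) (ℚ.*-zeroʳ (order H))))
      slack≡0 : slack H w ≡ 0ℚ
      slack≡0 = proj₂ (nonneg-+≡0 (0≤gap (delete H w)) (0≤slack H w)
        (trans (sym (⟦⟧-yes* (w ∈? vertices H) _ (Edge⇒∈′ H x–w))) (terms≡0 w)))

    LocallyClosed⇒slack≡0 : (H : Subgraph G) → LocallyClosed H → ∀ w → slack H w ≡ 0ℚ
    LocallyClosed⇒slack≡0 H loc w = ∑-zero _ λ x → trans
      (⟦⟧*-cong (Edge? H x w) λ x–w → trans (cong (_- inv (nbrs H w x)) (⇒tight H x–w (loc x–w))) (p-p≡0 (inv (nbrs H w x))))
      (ℚ.*-zeroʳ (E H x w))

    LocallyClosed⇒gap≡0-bounded : ∀ m (H : Subgraph G) → ∣ vertices H ∣ ℕ.< m → LocallyClosed H → gap H ≡ 0ℚ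
    LocallyClosed⇒gap≡0-bounded (ℕ.suc m) H (ℕ.s≤s ∣H∣≤m) loc with nonempty? (vertices H)
    ... | no empty = gap-empty H empty
    ... | yes ne   = *-cancelˡ-≢0 (gap H) 0ℚ (<⇒≢0 (0<order H ne)) (trans (gap-delete H) (trans
      (∑-zero _ λ w → trans
        (⟦⟧*-cong (w ∈? vertices H) λ w∈H → cong₂ _+_
          (LocallyClosed⇒gap≡0-bounded m (delete H w) (ℕ.<-≤-trans (x∈p⇒∣p-x∣<∣p∣ w∈H) ∣H∣≤m) (LocallyClosed-delete H loc))
          (LocallyClosed⇒slack≡0 H loc w))
        (ℚ.*-zeroʳ (V H w)))
      (sym (ℚ.*-zeroʳ (order H)))))

    LocallyClosed⇒gap≡0 : (H : Subgraph G) → LocallyClosed H → gap H ≡ 0ℚ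
    LocallyClosed⇒gap≡0 H = LocallyClosed⇒gap≡0-bounded (ℕ.suc ∣ vertices H ∣) H ℕ.≤-refl

    -- Local closedness of the whole graph and its blocks.

    full : Subgraph G
    full = record
      { vertices = ⊤
      ; Edge     = Graph.Adj G
      ; Edge?    = Graph.Adj? G
      ; Edge-sym = Graph.sym G
      ; Edge⇒∈   = λ _ → ∈⊤
      ; Edge⇒Adj = λ e → e
      }

    induced : Subset n → Subgraph G
    induced X = record
      { vertices = X
      ; Edge     = λ u v → u ∈ X × v ∈ X × Graph.Adj G u v
      ; Edge?    = λ u v → (u ∈? X) ×-dec (v ∈? X) ×-dec Graph.Adj? G u v
      ; Edge-sym = λ (u∈X , v∈X , e) → v∈X , u∈X , Graph.sym G e
      ; Edge⇒∈   = proj₁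
      ; Edge⇒Adj = λ (_ , _ , e) → e
      }

    Edge⇒induced : (H : Subgraph G) → ∀ {X u v} → vertices H ⊆ X → Edge H u v → Edge (induced X) u v
    Edge⇒induced H H⊆X e = H⊆X (Edge⇒∈ H e) , H⊆X (Edge⇒∈′ H e) , Edge⇒Adj H e

    Conn-∈ : (H : Subgraph G) → ∀ {u v} → u ∈ vertices H → Conn H u v → v ∈ vertices H
    Conn-∈ H u∈H ε       = u∈H
    Conn-∈ H _   (e ◅ p) = Conn-∈ H (Edge⇒∈′ H e) p

    Conn-≢-∈ : (H : Subgraph G) → ∀ {u v} → u ≢ v → Conn H u v → u ∈ vertices H
    Conn-≢-∈ H u≢u ε       = contradiction refl u≢u
    Conn-≢-∈ H _   (e ◅ _) = Edge⇒∈ H e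

    Hub : Subgraph G → Fin n → Set
    Hub H h = ∀ {u} → u ∈ vertices H → Conn H u h

    Hub⇒Conn : (H : Subgraph G) → ∀ {h u v} → Hub H h → u ∈ vertices H → v ∈ vertices H → Conn H u v
    Hub⇒Conn H hub u∈H v∈H = hub u∈H ◅◅ Conn-sym H (hub v∈H)

    -- Adding edges on the same vertices only adds walks. Since subgraphs need not be induced, this
    -- is what lets maximality supply missing edges to a block, and lets biconnected subgraphs be
    -- compared by their vertex sets.
    induced-Biconnected : (H : Subgraph G) → Biconnected H → Biconnected (induced (vertices H))
    induced-Biconnected H ((ne , conn) , no-cut) =
      (ne , λ u∈H v∈H → Star-map (Edge⇒induced H (λ x → x)) (conn u∈H v∈H)) ,
      λ x (x∈H , u , v , u∈H-x , v∈H-x , _ , split) → no-cut x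
        (x∈H , u , v , u∈H-x , v∈H-x , conn (proj₁ (∈-delete⁻ H u∈H-x)) (proj₁ (∈-delete⁻ H v∈H-x)) ,
         split ∘ Star-map (λ (e , ≢x) → Edge⇒induced H (λ x → x) e , ≢x))

    -- Take a walk u, x, ..., v in the block. By induction along it x is adjacent to v, unless they
    -- coincide; as x is no cut vertex, u and v stay connected without x, and local closedness at x
    -- makes them adjacent. Maximality against the induced subgraph turns adjacency in `G` into an
    -- edge of `H`.
    LocallyClosed⇒blocks-cliques : LocallyClosed full → (H : Subgraph G) → IsBlock H → IsClique H
    LocallyClosed⇒blocks-cliques closed H (bi@((_ , conn) , no-cut) , maximal) u∈H v∈H u≢v =
      proj₂ (maximal (induced (vertices H)) (induced-Biconnected H bi) ((λ x → x) , Edge⇒induced H (λ x → x)))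
        (u∈H , v∈H , adjacent v∈H (conn u∈H v∈H) u≢v)
      where
      adjacent : ∀ {u v} → v ∈ vertices H → Conn H u v → u ≢ v → Graph.Adj G u v
      adjacent v∈H ε u≢u = contradiction refl u≢u
      adjacent {u} {v} v∈H (_◅_ {j = x} u–x p) u≢v with x ≟ v
      ... | yes refl = Edge⇒Adj H u–x
      ... | no x≢v   = closed (Edge⇒Adj H u–x) (Graph.sym G (adjacent v∈H p x≢v)) u≢v
        (Star-map (λ (e , ≢x) → Edge⇒Adj H e , ≢x)
          (decidable-stable (Conn? (delete H x) u v) λ split →
            no-cut x (Edge⇒∈′ H u–x , u , v , ∈-delete⁺ H (Edge⇒∈ H u–x) (Edge-≢ H u–x) ,
                      ∈-delete⁺ H v∈H (x≢v ∘ sym) , u–x ◅ p , split)))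

    -- A stand-in for a path without repeated vertices: every vertex of `X` is indispensable for
    -- connecting `x` with `y`.
    Minimal : Subgraph G → Fin n → Fin n → Set
    Minimal X x y = Conn X x y × (∀ {p} → p ∈ vertices X → ¬ Conn (delete X p) x y)

    ∃-minimal-bounded : ∀ m (X : Subgraph G) → ∣ vertices X ∣ ℕ.< m → ∀ {x y} → Conn X x y →
                        ∃ λ Y → Y ≤ₛ X × Minimal Y x y
    ∃-minimal-bounded (ℕ.suc m) X (ℕ.s≤s ∣X∣≤m) {x} {y} x~y
      with any? (λ p → (p ∈? vertices X) ×-dec Conn? (delete X p) x y)
    ... | no minimal = X , ((λ z → z) , λ e → e) , x~y , λ p∈X x~y′ → minimal (_ , p∈X , x~y′)
    ... | yes (p , p∈X , x~y′) =
      let Y , (Y⊆X-p , edges) , min = ∃-minimal-bounded m (delete X p) (ℕ.<-≤-trans (x∈p⇒∣p-x∣<∣p∣ p∈X) ∣X∣≤m) x~y′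
      in Y , ((λ z∈Y → proj₁ (∈-delete⁻ X (Y⊆X-p z∈Y))) , λ e → proj₁ (edges e)) , min

    ∃-minimal : (X : Subgraph G) → ∀ {x y} → Conn X x y → ∃ λ Y → Y ≤ₛ X × Minimal Y x y
    ∃-minimal X = ∃-minimal-bounded (ℕ.suc ∣ vertices X ∣) X ℕ.≤-refl

    -- Before its first arrival at `p` the walk stays in `delete X p`; if it met `q` there, then `q`
    -- would be connected to `a` without `p`.
    detour : (X : Subgraph G) → ∀ {p q a} → q ≢ p → Conn X a p → ¬ Conn (delete X p) q a → Conn (delete X q) a p
    detour X q≢p ε q≁a = ε
    detour X {p} {q} {a} q≢p (_◅_ {j = b} a–b b~p) q≁a with a ≟ p | b ≟ p
    ... | yes refl | _        = ε
    ... | no a≢p   | yes refl = (a–b , (λ { refl → q≁a ε }) , q≢p ∘ sym) ◅ ε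
    ... | no a≢p   | no b≢p   = (a–b , (λ { refl → q≁a ε }) , (λ { refl → q≁b ε })) ◅ detour X q≢p b~p q≁b
      where
      q≁b : ¬ Conn (delete X p) q b
      q≁b q~b = q≁a (q~b ◅◅ ((Edge-sym X a–b , b≢p , a≢p) ◅ ε))

    -- A minimal connection together with a common neighbour of its ends is a cycle.
    module _ (X : Subgraph G) {w x y : Fin n} (w∉X : w ∉ vertices X) (x≢y : x ≢ y)
             (x–w : Graph.Adj G x w) (y–w : Graph.Adj G y w) (min : Minimal X x y) where

      private
        x~y : Conn X x y
        x~y = proj₁ min

        x∈X : x ∈ vertices X
        x∈X = Conn-≢-∈ X x≢y x~y

        y∈X : y ∈ vertices X
        y∈X = Conn-≢-∈ X (x≢y ∘ sym) (Conn-sym X x~y)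

        -- A vertex not connected to `x` could be deleted without harm to the connection, against
        -- minimality.
        through : ∀ {p} → p ∈ vertices X → Conn X x p
        through {p} p∈X = decidable-stable (Conn? X x p) λ x≁p → proj₂ min p∈X (avoids X x≁p x~y)

        -- If `q` reached neither end without `p`, then by `detour` both ends would reach `p`
        -- without `q`, and `q` would be dispensable.
        to-end : ∀ {p q} → p ∈ vertices X → q ∈ vertices X → q ≢ p →
                 Conn (delete X p) q x ⊎ Conn (delete X p) q y
        to-end {p} {q} p∈X q∈X q≢p with Conn? (delete X p) q x | Conn? (delete X p) q y
        ... | yes q~x | _       = inj₁ q~x
        ... | no _    | yes q~y = inj₂ q~y
        ... | no q≁x  | no q≁y  = contradiction
          (detour X q≢p x~p q≁x ◅◅ Conn-sym (delete X q) (detour X q≢p (Conn-sym X x~y ◅◅ x~p) q≁y))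
          (proj₂ min q∈X)
          where
          x~p : Conn X x p
          x~p = through p∈X

      cycle : Subset n
      cycle = vertices X ∪ ⁅ w ⁆

      X⊆cycle : vertices X ⊆ cycle
      X⊆cycle = x∈p∪q⁺ ∘ inj₁

      w∈cycle : w ∈ cycle
      w∈cycle = x∈p∪q⁺ (inj₂ (x∈⁅x⁆ w))

      ∈-cycle⁻ : ∀ {u} → u ∈ cycle → u ∈ vertices X ⊎ u ≡ w
      ∈-cycle⁻ u∈ with x∈p∪q⁻ (vertices X) ⁅ w ⁆ u∈
      ... | inj₁ u∈X = inj₁ u∈X
      ... | inj₂ u∈w = inj₂ (x∈⁅y⁆⇒x≡y w u∈w)

      private
        C : Subgraph G
        C = induced cycle

        -- Here `z` is an end of the connection. Being reached inside `delete X p` it differs from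
        -- `p`, so its edge to `w` survives even when `p` is the other end.
        to-hub : ∀ {p u z} → p ∈ vertices X → u ∈ vertices (delete X p) →
                 Conn (delete X p) u z → Graph.Adj G z w → Conn (delete C p) u w
        to-hub {p} p∈X u∈ u~z z–w =
          let z∈X , z≢p = ∈-delete⁻ X (Conn-∈ (delete X p) u∈ u~z)
          in Star-map (λ (e , ≢p) → Edge⇒induced X X⊆cycle e , ≢p) u~z ◅◅
             (((X⊆cycle z∈X , w∈cycle , z–w) , z≢p , (λ { refl → w∉X p∈X })) ◅ ε)

        hub-delete-w : Hub (delete C w) x
        hub-delete-w u∈ with ∈-delete⁻ C u∈
        ... | u∈C , u≢w with ∈-cycle⁻ u∈C
        ...   | inj₂ u≡w = contradiction u≡w u≢w
        ...   | inj₁ u∈X = Star-map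
          (λ e → Edge⇒induced X X⊆cycle e , (λ { refl → w∉X (Edge⇒∈ X e) }) , (λ { refl → w∉X (Edge⇒∈′ X e) }))
          (Conn-sym X (through u∈X))

        hub-delete-X : ∀ {p} → p ∈ vertices X → Hub (delete C p) w
        hub-delete-X {p} p∈X {u} u∈ with ∈-delete⁻ C u∈
        ... | u∈C , u≢p with ∈-cycle⁻ u∈C
        ...   | inj₂ refl = ε
        ...   | inj₁ u∈X with to-end p∈X u∈X u≢p
        ...     | inj₁ u~x = to-hub p∈X (∈-delete⁺ X u∈X u≢p) u~x x–w
        ...     | inj₂ u~y = to-hub p∈X (∈-delete⁺ X u∈X u≢p) u~y y–w

        hub : Hub C x
        hub u∈C with ∈-cycle⁻ u∈C
        ... | inj₂ refl = (w∈cycle , X⊆cycle x∈X , Graph.sym G x–w) ◅ ε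
        ... | inj₁ u∈X  = Star-map (Edge⇒induced X X⊆cycle) (Conn-sym X (through u∈X))

      cycle-Biconnected : Biconnected (induced cycle)
      cycle-Biconnected = ((w , w∈cycle) , Hub⇒Conn C hub) , no-cut
        where
        no-cut : ∀ p → ¬ IsCutVertex (induced cycle) p
        no-cut p (p∈C , u , v , u∈ , v∈ , _ , split) with ∈-cycle⁻ p∈C
        ... | inj₁ p∈X  = split (Hub⇒Conn (delete C p) (hub-delete-X p∈X) u∈ v∈)
        ... | inj₂ refl = split (Hub⇒Conn (delete C p) hub-delete-w u∈ v∈)

      x∈cycle : x ∈ cycle
      x∈cycle = X⊆cycle x∈X

      y∈cycle : y ∈ cycle
      y∈cycle = X⊆cycle y∈X

    -- Doubly negated, since maximality among all subgraphs is not decided here.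
    ¬¬block : ∀ X → Acc _⊃_ X → Biconnected (induced X) →
              ¬ (∀ (H : Subgraph G) → IsBlock H → ¬ (X ⊆ vertices H))
    ¬¬block X (acc larger) bi no-block = no-block (induced X) (bi , maximal) (λ x∈X → x∈X)
      where
      maximal : ∀ K → Biconnected K → induced X ≤ₛ K → K ≤ₛ induced X
      maximal K biK (X⊆K , _) = K⊆X , Edge⇒induced K K⊆X
        where
        K⊆X : vertices K ⊆ X
        -- A vertex of `K` outside `X` makes `vertices K` strictly larger than `X`, so the recursion
        -- applies to it, and a block above `K` also lies above `X`.
        K⊆X {z} z∈K = decidable-stable (z ∈? X) λ z∉X →
          ¬¬block (vertices K) (larger (X⊆K , z , z∈K , z∉X)) (induced-Biconnected K biK)
            (λ H block K⊆H → no-block H block (λ x∈X → K⊆H (X⊆K x∈X)))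

    -- The cycle through x, w and y is biconnected, hence contained in a block, which is a clique.
    -- Adjacency is decidable, so it is enough to have this block up to double negation.
    blocks-cliques⇒LocallyClosed : ((H : Subgraph G) → IsBlock H → IsClique H) → LocallyClosed full
    blocks-cliques⇒LocallyClosed cliques {w} {x} {y} x–w y–w x≢y x~y =
      decidable-stable (Graph.Adj? G x y) λ x≁y →
        let X , (X⊆ , _) , min = ∃-minimal (delete full w) x~y
            w∉X : w ∉ vertices X
            w∉X w∈X = proj₂ (∈-delete⁻ full (X⊆ w∈X)) refl
        in ¬¬block (cycle X w∉X x≢y x–w y–w min) (⊃-wellFounded _) (cycle-Biconnected X w∉X x≢y x–w y–w min)
             λ H block ⊆H → x≁y (Edge⇒Adj H (cliques H block
               (⊆H (x∈cycle X w∉X x≢y x–w y–w min)) (⊆H (y∈cycle X w∉X x≢y x–w y–w min)) x≢y))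

  -- Fractions of integers as rationals.

  fromℕ : ℕ → ℚ
  fromℕ m = (ℤ.+ m) / 1

  -- Normalisation by the gcd is stuck on variables, so the identities on fractions below are
  -- checked by cross-multiplying unnormalised ones.
  toℚᵘ-/ : ∀ i k → ℚ.toℚᵘ (i / ℕ.suc k) ℚᵘ.≃ mkℚᵘ i k
  toℚᵘ-/ i k = ℚ.toℚᵘ-fromℚᵘ (mkℚᵘ i k)

  fromℕ-suc : ∀ m → fromℕ (ℕ.suc m) ≡ 1ℚ + fromℕ m
  fromℕ-suc m = ℚ.toℚᵘ-injective (begin
    ℚ.toℚᵘ (fromℕ (ℕ.suc m))                   ≈⟨ toℚᵘ-/ (ℤ.+ (ℕ.suc m)) 0 ⟩
    mkℚᵘ (ℤ.+ (ℕ.suc m)) 0                     ≈⟨ *≡* (cong (λ i → (ℤ.+ 1 ℤ.+ i) ℤ.* (ℤ.+ 1)) (sym (ℤ.*-identityʳ (ℤ.+ m)))) ⟩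
    mkℚᵘ (ℤ.+ 1) 0 ℚᵘ.+ mkℚᵘ (ℤ.+ m) 0         ≈⟨ ℚᵘ.+-congʳ (mkℚᵘ (ℤ.+ 1) 0) (toℚᵘ-/ (ℤ.+ m) 0) ⟨
    ℚ.toℚᵘ 1ℚ ℚᵘ.+ ℚ.toℚᵘ (fromℕ m)            ≈⟨ ℚ.toℚᵘ-homo-+ 1ℚ (fromℕ m) ⟨
    ℚ.toℚᵘ (1ℚ + fromℕ m)                      ∎)
    where open ℚᵘ.≃-Reasoning

  fromℕ-*-1/ : ∀ k → fromℕ (ℕ.suc k) * ((ℤ.+ 1) / ℕ.suc k) ≡ 1ℚ
  fromℕ-*-1/ k = ℚ.toℚᵘ-injective (begin
    ℚ.toℚᵘ (fromℕ (ℕ.suc k) * ((ℤ.+ 1) / ℕ.suc k))            ≈⟨ ℚ.toℚᵘ-homo-* (fromℕ (ℕ.suc k)) ((ℤ.+ 1) / ℕ.suc k) ⟩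
    ℚ.toℚᵘ (fromℕ (ℕ.suc k)) ℚᵘ.* ℚ.toℚᵘ ((ℤ.+ 1) / ℕ.suc k)  ≈⟨ ℚᵘ.*-cong (toℚᵘ-/ (ℤ.+ (ℕ.suc k)) 0) (toℚᵘ-/ (ℤ.+ 1) k) ⟩
    mkℚᵘ (ℤ.+ (ℕ.suc k)) 0 ℚᵘ.* mkℚᵘ (ℤ.+ 1) k                ≈⟨ *≡* (trans (ℤ.*-identityʳ _) (trans (ℤ.*-comm (ℤ.+ (ℕ.suc k)) (ℤ.+ 1)) (cong (λ m → (ℤ.+ 1) ℤ.* (ℤ.+ m)) (sym (ℕ.*-identityˡ (ℕ.suc k)))))) ⟩
    mkℚᵘ (ℤ.+ 1) 0                                            ∎)
    where open ℚᵘ.≃-Reasoning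

  halves : ∀ i → i / 2 + i / 2 ≡ i / 1
  halves i = ℚ.toℚᵘ-injective (begin
    ℚ.toℚᵘ (i / 2 + i / 2)              ≈⟨ ℚ.toℚᵘ-homo-+ (i / 2) (i / 2) ⟩
    ℚ.toℚᵘ (i / 2) ℚᵘ.+ ℚ.toℚᵘ (i / 2)  ≈⟨ ℚᵘ.+-cong (toℚᵘ-/ i 1) (toℚᵘ-/ i 1) ⟩
    mkℚᵘ i 1 ℚᵘ.+ mkℚᵘ i 1              ≈⟨ *≡* (trans (ℤ.*-identityʳ _) (sym (ℤ.*-distribˡ-+ i (ℤ.+ 2) (ℤ.+ 2)))) ⟩
    mkℚᵘ i 0                            ≈⟨ toℚᵘ-/ i 0 ⟨
    ℚ.toℚᵘ (i / 1)                      ∎)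
    where open ℚᵘ.≃-Reasoning

  1/-≡-inv : ∀ k → (ℤ.+ 1) / (2 ℕ.+ k) ≡ inv (1ℚ + 1ℚ + fromℕ k)
  1/-≡-inv k = *-cancelˡ-≢0 r (inv q) q≢0 (trans qr≡1 (sym (*-inv q≢0)))
    where
    q r : ℚ
    q = 1ℚ + 1ℚ + fromℕ k
    r = (ℤ.+ 1) / (2 ℕ.+ k)
    q≡ : q ≡ fromℕ (2 ℕ.+ k)
    q≡ = trans (ℚ.+-assoc 1ℚ 1ℚ (fromℕ k)) (sym (trans (fromℕ-suc (ℕ.suc k)) (cong (1ℚ +_) (fromℕ-suc k))))
    qr≡1 : q * r ≡ 1ℚ
    qr≡1 = trans (cong (_* r) q≡) (fromℕ-*-1/ (ℕ.suc k))
    q≢0 : q ≢ 0ℚ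
    q≢0 q≡0 with trans (sym qr≡1) (trans (cong (_* r) q≡0) (ℚ.*-zeroˡ r))
    ... | ()

  -- Sums over lists as sums over indices.

  listSum : List ℚ → ℚ
  listSum = foldr _+_ 0ℚ

  opaque
    unfolding ∑

    ∑-1 : ∀ n → ∑ {n} (λ _ → 1ℚ) ≡ fromℕ n
    ∑-1 ℕ.zero    = refl
    ∑-1 (ℕ.suc n) = trans (cong (1ℚ +_) (∑-1 n)) (sym (fromℕ-suc n))

    ∑-∈ : ∀ {n} (p : Subset n) → ∑ (λ i → ⟦ i ∈? p ⟧) ≡ fromℕ ∣ p ∣
    ∑-∈ []            = refl
    ∑-∈ (inside ∷ p)  = trans (cong (1ℚ +_) (trans (∑-cong (λ i → ⟦⟧-cong (suc i ∈? inside ∷ p) (i ∈? p) drop-there there)) (∑-∈ p))) (sym (fromℕ-suc ∣ p ∣))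
    ∑-∈ (outside ∷ p) = trans (ℚ.+-identityˡ _) (trans (∑-cong (λ i → ⟦⟧-cong (suc i ∈? outside ∷ p) (i ∈? p) drop-there there)) (∑-∈ p))

    listSum-tabulate : ∀ {n} (f : Fin n → ℚ) → listSum (List.tabulate f) ≡ ∑ f
    listSum-tabulate {ℕ.zero}  f = refl
    listSum-tabulate {ℕ.suc n} f = cong (f zero +_) (listSum-tabulate (f ∘ suc))

  listSum-allFin : ∀ {n} (f : Fin n → ℚ) → listSum (map f (allFin n)) ≡ ∑ f
  listSum-allFin f = trans (cong listSum (map-tabulate (λ i → i) f)) (listSum-tabulate f)

  listSum-++ : ∀ xs ys → listSum (xs ++ ys) ≡ listSum xs + listSum ys
  listSum-++ []       ys = sym (ℚ.+-identityˡ (listSum ys))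
  listSum-++ (x ∷ xs) ys = trans (cong (x +_) (listSum-++ xs ys)) (sym (ℚ.+-assoc x (listSum xs) (listSum ys)))

  listSum-filter : {A : Set} {P : A → Set} (P? : Unary.Decidable P) (f : A → ℚ) → ∀ xs →
                   listSum (map f (filter P? xs)) ≡ listSum (map (λ x → ⟦ P? x ⟧ * f x) xs)
  listSum-filter P? f []       = refl
  listSum-filter P? f (x ∷ xs) with P? x
  ... | yes _ = cong₂ _+_ (sym (ℚ.*-identityˡ (f x))) (listSum-filter P? f xs)
  ... | no _  = trans (listSum-filter P? f xs) (sym (trans (cong (_+ listSum (map (λ x → ⟦ P? x ⟧ * f x) xs)) (ℚ.*-zeroˡ (f x))) (ℚ.+-identityˡ _)))

  listSum-cartesianProduct : {A B : Set} (f : A × B → ℚ) → ∀ xs ys →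
    listSum (map f (cartesianProduct xs ys)) ≡ listSum (map (λ x → listSum (map (λ y → f (x , y)) ys)) xs)
  listSum-cartesianProduct f []       ys = refl
  listSum-cartesianProduct f (x ∷ xs) ys = begin
    listSum (map f (map (x ,_) ys ++ cartesianProduct xs ys))
      ≡⟨ cong listSum (map-++ f (map (x ,_) ys) (cartesianProduct xs ys)) ⟩
    listSum (map f (map (x ,_) ys) ++ map f (cartesianProduct xs ys))
      ≡⟨ listSum-++ (map f (map (x ,_) ys)) _ ⟩
    listSum (map f (map (x ,_) ys)) + listSum (map f (cartesianProduct xs ys))
      ≡⟨ cong₂ _+_ (cong listSum (sym (map-∘ ys))) (listSum-cartesianProduct f xs ys) ⟩
    listSum (map (λ y → f (x , y)) ys) + listSum (map (λ x → listSum (map (λ y → f (x , y)) ys)) xs) ∎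
    where open ≡-Reasoning

  -- The gap of the whole graph and the sum over its edges.

  module _ {n} (G : Graph n) where

    open Graph G using (Adj; Adj?; N; weight; edges; edgeSum)

    private
      H : Subgraph G
      H = full

    ascending? : ∀ u v → Dec (u Fin.< v × Adj u v)
    ascending? u v = (u <? v) ×-dec Adj? u v

    edgeSum≡∑ : (f : Fin n → Fin n → ℚ) → edgeSum f ≡ ∑ (λ u → ∑ (λ v → ⟦ ascending? u v ⟧ * f u v))
    edgeSum≡∑ f = begin
      edgeSum f
        ≡⟨ listSum-filter (λ (u , v) → ascending? u v) f′ (cartesianProduct (allFin n) (allFin n)) ⟩
      listSum (map (λ (u , v) → ⟦ ascending? u v ⟧ * f u v) (cartesianProduct (allFin n) (allFin n)))
        ≡⟨ listSum-cartesianProduct (λ (u , v) → ⟦ ascending? u v ⟧ * f u v) (allFin n) (allFin n) ⟩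
      listSum (map (λ u → listSum (map (λ v → ⟦ ascending? u v ⟧ * f u v) (allFin n))) (allFin n))
        ≡⟨ listSum-allFin _ ⟩
      ∑ (λ u → listSum (map (λ v → ⟦ ascending? u v ⟧ * f u v) (allFin n)))
        ≡⟨ ∑-cong (λ u → listSum-allFin (λ v → ⟦ ascending? u v ⟧ * f u v)) ⟩
      ∑ (λ u → ∑ (λ v → ⟦ ascending? u v ⟧ * f u v)) ∎
      where
      open ≡-Reasoning
      f′ : Fin n × Fin n → ℚ
      f′ (u , v) = f u v

    ∈-N⁻ : ∀ {u v} → v ∈ N u → Adj u v
    ∈-N⁻ {u} {v} v∈ = does-true (Adj? u v) (trans (sym (lookup∘tabulate (λ v → does (Adj? u v)) v)) ([]=⇒lookup v∈))
      where
      does-true : {P : Set} (d : Dec P) → does d ≡ true → P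
      does-true (yes p) _ = p

    ∈-N⁺ : ∀ {u v} → Adj u v → v ∈ N u
    ∈-N⁺ {u} {v} u–v = lookup⇒[]= v (N u) (trans (lookup∘tabulate (λ v → does (Adj? u v)) v) (dec-true (Adj? u v) u–v))

    weight≡i₂ : ∀ u v → weight u v ≡ i₂ H u v
    weight≡i₂ u v = trans (1/-≡-inv ∣ N u ∩ N v ∣) (cong (λ c → inv (1ℚ + 1ℚ + c)) (trans (sym (∑-∈ (N u ∩ N v)))
      (∑-cong λ w → trans
        (⟦⟧-cong (w ∈? N u ∩ N v) (Adj? u w ×-dec Adj? v w)
          (λ w∈ → let w∈u , w∈v = x∈p∩q⁻ (N u) (N v) w∈ in ∈-N⁻ w∈u , ∈-N⁻ w∈v)
          (λ (u–w , v–w) → x∈p∩q⁺ (∈-N⁺ u–w , ∈-N⁺ v–w)))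
        (⟦⟧-× (Adj? u w) (Adj? v w)))))

    i₂-comm : ∀ u v → i₂ H u v ≡ i₂ H v u
    i₂-comm u v = cong (λ c → inv (1ℚ + 1ℚ + c)) (∑-cong (λ w → ℚ.*-comm (E H u w) (E H v w)))

    -- Each edge is ascending in exactly one of its two orientations, whence the factor 2 between
    -- ordered pairs and listed edges.
    E-split : ∀ u v → E H u v ≡ ⟦ ascending? u v ⟧ + ⟦ ascending? v u ⟧
    E-split u v with <-cmp u v
    ... | tri< u<v _ v≮u = trans (⟦⟧-cong (Adj? u v) (ascending? u v) (λ e → u<v , e) proj₂)
                                 (sym (trans (cong (⟦ ascending? u v ⟧ +_) (⟦⟧-no (ascending? v u) (v≮u ∘ proj₁))) (ℚ.+-identityʳ ⟦ ascending? u v ⟧)))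
    ... | tri≈ u≮v u≡v v≮u = trans (⟦⟧-no (Adj? u v) (Graph.irrefl G u≡v))
                                   (sym (cong₂ _+_ (⟦⟧-no (ascending? u v) (u≮v ∘ proj₁)) (⟦⟧-no (ascending? v u) (v≮u ∘ proj₁))))
    ... | tri> u≮v _ v<u = trans (⟦⟧-cong (Adj? u v) (ascending? v u) (λ e → v<u , Graph.sym G e) (Graph.sym G ∘ proj₂))
                                 (sym (trans (cong (_+ ⟦ ascending? v u ⟧) (⟦⟧-no (ascending? u v) (u≮v ∘ proj₁))) (ℚ.+-identityˡ ⟦ ascending? v u ⟧)))

    pairSum-full : pairSum H ≡ edgeSum weight + edgeSum weight
    pairSum-full = begin
      pairSum H
        ≡⟨ ∑-cong (λ u → trans (∑-cong (λ v → trans (cong (_* i₂ H u v) (E-split u v)) (ℚ.*-distribʳ-+ (i₂ H u v) ⟦ ascending? u v ⟧ ⟦ ascending? v u ⟧)))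
             (∑-+ (up u) (down u))) ⟩
      ∑ (λ u → ∑ (up u) + ∑ (down u))
        ≡⟨ ∑-+ (λ u → ∑ (up u)) (λ u → ∑ (down u)) ⟩
      ∑ (λ u → ∑ (up u)) + ∑ (λ u → ∑ (down u))
        ≡⟨ cong (∑ (λ u → ∑ (up u)) +_) (trans (∑-comm down) (∑-cong (λ v → ∑-cong (λ u → cong (⟦ ascending? v u ⟧ *_) (i₂-comm u v))))) ⟩
      ∑ (λ u → ∑ (up u)) + ∑ (λ u → ∑ (up u))
        ≡⟨ cong₂ _+_ once once ⟩
      edgeSum weight + edgeSum weight ∎
      where
      open ≡-Reasoning
      up down : Fin n → Fin n → ℚ
      up   u v = ⟦ ascending? u v ⟧ * i₂ H u v
      down u v = ⟦ ascending? v u ⟧ * i₂ H u v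
      once : ∑ (λ u → ∑ (up u)) ≡ edgeSum weight
      once = sym (trans (edgeSum≡∑ weight) (∑-cong (λ u → ∑-cong (λ v → cong (⟦ ascending? u v ⟧ *_) (weight≡i₂ u v)))))

    order-full : order H ≡ fromℕ n
    order-full = trans (∑-cong (λ u → ⟦⟧-yes (u ∈? ⊤) ∈⊤)) (∑-1 n)

    comps-full : Graph.Connected G → comps H ≡ 1ℚ
    comps-full (r , conn) = begin
      comps H
        ≡⟨ ∑-cong (λ u → cong (λ s → V H u * inv s) (∑-cong (λ x → trans (cong (V H x *_) (⟦⟧-yes (Conn? H u x) (conn u x))) (ℚ.*-identityʳ (V H x))))) ⟩
      ∑ (λ u → V H u * inv (order H))
        ≡⟨ ∑-* (inv (order H)) (V H) ⟨
      order H * inv (order H)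
        ≡⟨ *-inv (<⇒≢0 (0<order H (r , ∈⊤))) ⟩
      1ℚ ∎
      where open ≡-Reasoning

    bound : ℚ
    bound = (ℤ.+ n ℤ.- ℤ.+ 1) / 2

    gap-full : Graph.Connected G → gap H ≡ (edgeSum weight - bound) + (edgeSum weight - bound)
    gap-full conn = begin
      pairSum H + comps H - order H
        ≡⟨ cong₂ (λ p q → p + q - order H) pairSum-full (comps-full conn) ⟩
      S + S + 1ℚ - order H
        ≡⟨ cong (λ o → S + S + 1ℚ - o) order≡ ⟩
      S + S + 1ℚ - (1ℚ + (bound + bound))
        ≡⟨ solve 2 (λ s b → s :+ s :+ con 1ℚ :- (con 1ℚ :+ (b :+ b)) := (s :- b) :+ (s :- b)) refl S bound ⟩
      (S - bound) + (S - bound) ∎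
      where
      open ≡-Reasoning
      S : ℚ
      S = edgeSum weight
      -- The vertex supplied by `Connected` excludes m = 0, where the integer difference is -1 but
      -- the predecessor is 0.
      pos-pred : ∀ {m} → Fin m → ℤ.+ m ℤ.- ℤ.+ 1 ≡ ℤ.+ ℕ.pred m
      pos-pred {ℕ.suc m} _ = refl
      suc-pred : ∀ {m} → Fin m → ℕ.suc (ℕ.pred m) ≡ m
      suc-pred {ℕ.suc m} _ = refl
      order≡ : order H ≡ 1ℚ + (bound + bound)
      order≡ = begin
        order H                          ≡⟨ order-full ⟩
        fromℕ n                          ≡⟨ cong fromℕ (suc-pred (proj₁ conn)) ⟨
        fromℕ (ℕ.suc (ℕ.pred n))         ≡⟨ fromℕ-suc (ℕ.pred n) ⟩
        1ℚ + fromℕ (ℕ.pred n)            ≡⟨ cong (λ i → 1ℚ + i / 1) (pos-pred (proj₁ conn)) ⟨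
        1ℚ + (ℤ.+ n ℤ.- ℤ.+ 1) / 1       ≡⟨ cong (1ℚ +_) (halves (ℤ.+ n ℤ.- ℤ.+ 1)) ⟨
        1ℚ + (bound + bound)             ∎

    bound≤edgeSum : Graph.Connected G → bound ≤ edgeSum weight
    bound≤edgeSum conn = 0≤q-p⇒p≤q (*-cancel-0≤ {1ℚ + 1ℚ} (ℚ.positive⁻¹ (1ℚ + 1ℚ))
      (subst (0ℚ ≤_) (trans (gap-full conn) (solve 1 (λ x → x :+ x := (con 1ℚ :+ con 1ℚ) :* x) refl (edgeSum weight - bound))) (0≤gap H)))

    edgeSum≡bound⇔ : Graph.Connected G → (edgeSum weight ≡ bound) ⇔ (∀ (K : Subgraph G) → IsBlock K → IsClique K)
    edgeSum≡bound⇔ conn = mk⇔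
      (λ eq → LocallyClosed⇒blocks-cliques (gap≡0⇒LocallyClosed H
        (trans (gap-full conn) (cong (λ x → x + x) (trans (cong (_- bound) eq) (p-p≡0 bound))))))
      (λ cliques → p-q≡0⇒p≡q (edgeSum weight) bound (proj₁ (nonneg-+≡0 0≤diff 0≤diff
        (trans (sym (gap-full conn)) (LocallyClosed⇒gap≡0 H (blocks-cliques⇒LocallyClosed cliques))))))
      where
      0≤diff : 0ℚ ≤ edgeSum weight - bound
      0≤diff = p≤q⇒0≤q-p (bound≤edgeSum conn)

open import Data.Integer using (+_; _-_)

theorem1 : ∀ (n : ℕ) (G : Graph n) → Graph.Connected G →
    (Graph.edgeSum G (Graph.weight G) ≥ (+ n - + 1) / 2) ×
    ((Graph.edgeSum G (Graph.weight G) ≡ (+ n - + 1) / 2) ⇔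
    (∀ (H : Subgraph G) → IsBlock H → IsClique H))
theorem1 n G conn = Gap.bound≤edgeSum G conn , Gap.edgeSum≡bound⇔ G conn
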